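{- There is a randomized algorithm that, given cut-query access to an undirected unweighted graph $G=(V,E)$ on $n$ vertices with two designated terminals $s,t\in V$, computes a minimum $s$-$t$ cut of $G$. The algorithm always makes $\widetilde{O}(n^{8/5})$ cut queries to $G$ and succeeds with high probability.
   Context: Cut-query model: the graph $G$ is hidden; the algorithm may submit any partition $(S,V\setminus S)$ of $V$ to an oracle, which returns the number $|E_G(S,V\setminus S)|$ of edges of $G$ with one endpoint in $S$ and the other in $V\setminus S$. Only the number of queries is counted (local computation is free). An $s$-$t$ cut is a partition $(S,T)$ of $V$ with $s\in S$, $t\in T$; a minimum $s$-$t$ cut minimizes $|E_G(S,T)|$. $\widetilde{O}(\cdot)$ hides polylogarithmic factors in $n$; "with high probability" means with probability at least $1-1/\mathrm{poly}(n)$. -}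

module Defs where

open import Data.Nat using (ℕ; zero; suc; _+_; _*_; _^_; _≤_)
open import Data.Nat.Logarithm using (⌊log₂_⌋)
open import Data.Fin using (Fin; zero; suc)
open import Data.Bool using (Bool; true; false; _∧_; not; if_then_else_)
open import Data.Product using (_×_; _,_; proj₁; proj₂; Σ; ∃)
open import Data.List using (List; length)
open import Data.List.Membership.Propositional using (_∈_)
open import Relation.Binary.PropositionalEquality using (_≡_)
open import Relation.Nullary using (¬_)

sumFin : (n : ℕ) → (Fin n → ℕ) → ℕ
sumFin zero    f = 0
sumFin (suc n) f = f zero + sumFin n (λ i → f (suc i))

record Graph (n : ℕ) : Set where
  field
    adj   : Fin n → Fin n → Bool
    sym   : ∀ u v → adj u v ≡ adj v u
    loopless : ∀ u → adj u u ≡ false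
open Graph public

VSet : ℕ → Set
VSet n = Fin n → Bool

-- |E_G(S, V \ S)|: each edge {u,v} with u ∈ S, v ∉ S is counted exactly once
-- (as the ordered pair (u,v)).
cutSize : ∀ {n} → Graph n → VSet n → ℕ
cutSize {n} G S =
  sumFin n (λ u → sumFin n (λ v →
    if S u ∧ not (S v) ∧ adj G u v then 1 else 0))

IsSTCut : ∀ {n} → Fin n → Fin n → VSet n → Set
IsSTCut s t S = (S s ≡ true) × (S t ≡ false)

IsMinSTCut : ∀ {n} → Graph n → Fin n → Fin n → VSet n → Set
IsMinSTCut G s t S =
  IsSTCut s t S × (∀ S' → IsSTCut s t S' → cutSize G S ≤ cutSize G S')

-- Deterministic cut-query algorithm (decision tree): either output a set,
-- or submit a cut query S and continue depending on the answer (any ℕ).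
data QTree (n : ℕ) : Set where
  output : VSet n → QTree n
  query  : VSet n → (ℕ → QTree n) → QTree n

run : ∀ {n} → Graph n → QTree n → VSet n × ℕ
run G (output S)  = S , 0
run G (query S k) with run G (k (cutSize G S))
... | (R , q) = R , suc q

-- Randomized cut-query algorithm on n vertices: it uses `bits` uniformly
-- random bits, seeds are Fin (2 ^ bits), and for each seed it is a
-- deterministic decision tree.
record RandAlg (n : ℕ) : Set where
  field
    bits : ℕ
    tree : Fin (2 ^ bits) → QTree n
open RandAlg public

AlwaysWithin : ∀ {n} → RandAlg n → Graph n → ℕ → Set
AlwaysWithin A G bound = ∀ r → proj₂ (run G (tree A r)) ≤ bound

-- Pr[output is not a minimum s-t cut] ≤ 1 / n^c, i.e. the failing seeds are
-- covered by a list of length L with L * n^c ≤ 2^bits.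
SucceedsWHP : ∀ {n} → RandAlg n → Graph n → Fin n → Fin n → ℕ → Set
SucceedsWHP {n} A G s t c =
  Σ (List (Fin (2 ^ bits A))) λ bad →
    (length bad * n ^ c ≤ 2 ^ bits A) ×
    (∀ r → ¬ (r ∈ bad) → IsMinSTCut G s t (proj₁ (run G (tree A r))))

-- Õ(n^{8/5}) query bound, raised to the 5th power to stay in ℕ:
-- q ≤ (C n^8 (log n + 1)^k)^{1/5}  ⇔  q^5 ≤ C · n^8 · (⌊log₂ n⌋ + 1)^k.
WithinBound : ℕ → ℕ → ℕ → ℕ → Set
WithinBound C k n q = q ^ 5 ≤ C * n ^ 8 * (⌊log₂ n ⌋ + 1) ^ k

{-# OPTIONS --safe #-}

-- The algorithm is deterministic. Write d for roughly n^{3/5}.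
-- (1) A depth-first search for shortest augmenting paths, with distance labels up to d,
-- takes O(nd) steps. Afterwards some two consecutive levels together contain O(n/d)
-- vertices, so only r = O((n/d)²) augmentations remain.
-- (2) Peeling d spanning forests off the edges not yet known makes every vertex set that
-- is still crossed by a hidden edge also crossed by at least d forest edges.
-- (3) Let R be the set of vertices that reach t in the known residual graph. While no
-- augmentation is possible, learn a hidden edge entering R; when none exists, the
-- complement of R is a minimum cut. If R grows to R′, at least d forest edges cross
-- R′ ∖ R, and all of them carry flow. Let g be the flow added since (1). Cancelling cycles
-- costs no queries and keeps g acyclic, so a topological order bounds the support of g
-- by O(n√r). Hence each augmentation is preceded by only O(n√r / d) new edges, and the
-- total O(nd + r n√r / d) is O(n^{8/5}), up to the logarithm paid for locating an edge.
module Submission where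

open import Defs renaming (sym to adj-sym)
import Algebra.Properties.Semiring.Sum as SemiringSum
open import Data.Bool using (Bool; true; false; _∧_; _∨_; not; if_then_else_)
import Data.Bool.Properties as Bool
open import Data.Fin using (Fin; zero; suc; toℕ; fromℕ<)
import Data.Fin.Properties as Fin
open import Data.Integer as ℤ using (ℤ; -[1+_]; 0ℤ; 1ℤ; ∣_∣) renaming (+_ to int)
import Data.Integer.Properties as ℤ
open import Data.Integer.Tactic.RingSolver using () renaming (solve-∀ to solveᶻ-∀)
open import Data.List using ([])
open import Data.Maybe using (Maybe; just; nothing)
open import Data.Nat
open import Data.Nat.DivMod using (m≡m%n+[m/n]*n; m/n*n≤m; m%n<n)
open import Data.Nat.Logarithm using (⌊log₂_⌋; ⌊log₂⌋-mono-≤; ⌊log₂[2^n]⌋≡n)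
import Data.Nat.Properties as ℕ
open import Data.Nat.Tactic.RingSolver using (solve-∀)
open import Data.Product using (Σ; ∃; ∃₂; _×_; _,_; proj₁; proj₂)
open import Data.Sum using (_⊎_; inj₁; inj₂)
open import Function using (_∘_; id; case_of_)
open import Relation.Binary.PropositionalEquality
open import Relation.Nullary using (¬_; Dec; yes; no; does; contradiction)
open import Relation.Nullary.Decidable using (from-yes; map′; _×-dec_; _→-dec_)

-- The scale of d balances the two costs: with r of order (n/d)², the term r n√r / d is n⁴/d⁴, which
-- meets nd when d⁵ = n³. The obstacle is the number of edges learned between two augmentations.
-- They are charged to g and not to the whole flow, because only the value of g is known to be at
-- most r. This charging is possible because the forests are peeled after the flow of the first
-- phase is fixed: that flow vanishes on forest edges, so a saturated one lies in the support of g.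
-- Between augmentations the sets R only grow, so the increments of R are disjoint and no ordered
-- pair is charged twice. The support bound is a square-root argument. In an acyclic digraph the k
-- out-neighbours of a vertex lie at least 1, ..., k places below it in a topological order, so
-- squared degrees are paid for by rank drops. One unit of g accounts for a total drop of at most n.
-- Hence the squared degrees sum to O(nr) and the degrees to O(n√r).

private variable
  n : ℕ

-- Finite sums

module ℕΣ = SemiringSum ℕ.+-*-semiring
module ℤΣ = SemiringSum ℤ.+-*-semiring

𝟙 : Bool → ℕ
𝟙 b = if b then 1 else 0

_==_ : Fin n → Fin n → Bool
u == v = does (u Fin.≟ v)

==-refl : (u : Fin n) → (u == u) ≡ true
==-refl u with u Fin.≟ u
... | yes _ = refl
... | no u≢u = contradiction refl u≢u

==-≢ : {u v : Fin n} → u ≢ v → (u == v) ≡ false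
==-≢ {u = u} {v} u≢v with u Fin.≟ v
... | yes u≡v = contradiction u≡v u≢v
... | no _ = refl

δ : Fin n → Fin n → ℤ
δ u v = int (𝟙 (u == v))

opaque
  ∑ : (Fin n → ℕ) → ℕ
  ∑ = ℕΣ.sum

  ∑ᶻ : (Fin n → ℤ) → ℤ
  ∑ᶻ = ℤΣ.sum

  ∑₂ : (Fin n → Fin n → ℕ) → ℕ
  ∑₂ f = ∑ λ u → ∑ (f u)

  ∑ᶻ₂ : (Fin n → Fin n → ℤ) → ℤ
  ∑ᶻ₂ f = ∑ᶻ λ u → ∑ᶻ (f u)

  ∑-cong : {f g : Fin n → ℕ} → (∀ i → f i ≡ g i) → ∑ f ≡ ∑ g
  ∑-cong = ℕΣ.sum-cong-≗

  ∑-+ : (f g : Fin n → ℕ) → ∑ (λ i → f i + g i) ≡ ∑ f + ∑ g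
  ∑-+ = ℕΣ.∑-distrib-+

  *-∑ : (c : ℕ) (f : Fin n → ℕ) → c * ∑ f ≡ ∑ (λ i → c * f i)
  *-∑ = ℕΣ.*-distribˡ-sum

  ∑-swap : ∀ {m n} (f : Fin m → Fin n → ℕ) → ∑ (λ i → ∑ (f i)) ≡ ∑ (λ j → ∑ (λ i → f i j))
  ∑-swap = ℕΣ.∑-comm

  ∑₂-swap : (f : Fin n → Fin n → ℕ) → ∑₂ f ≡ ∑₂ (λ u v → f v u)
  ∑₂-swap = ℕΣ.∑-comm

  ∑₂-unfold : (f : Fin n → Fin n → ℕ) → ∑₂ f ≡ ∑ λ u → ∑ (f u)
  ∑₂-unfold f = refl

  sumFin≡∑ : (f : Fin n → ℕ) → sumFin n f ≡ ∑ f
  sumFin≡∑ {zero}  f = refl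
  sumFin≡∑ {suc n} f = cong (f zero +_) (sumFin≡∑ (f ∘ suc))

  ∑ᶻ-cong : {f g : Fin n → ℤ} → (∀ i → f i ≡ g i) → ∑ᶻ f ≡ ∑ᶻ g
  ∑ᶻ-cong = ℤΣ.sum-cong-≗

  ∑ᶻ-+ : (f g : Fin n → ℤ) → ∑ᶻ (λ i → f i ℤ.+ g i) ≡ ∑ᶻ f ℤ.+ ∑ᶻ g
  ∑ᶻ-+ = ℤΣ.∑-distrib-+

  *-∑ᶻ : (c : ℤ) (f : Fin n → ℤ) → c ℤ.* ∑ᶻ f ≡ ∑ᶻ (λ i → c ℤ.* f i)
  *-∑ᶻ = ℤΣ.*-distribˡ-sum

  ∑ᶻ₂-swap : (f : Fin n → Fin n → ℤ) → ∑ᶻ₂ f ≡ ∑ᶻ₂ (λ u v → f v u)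
  ∑ᶻ₂-swap = ℤΣ.∑-comm

  ∑ᶻ₂-unfold : (f : Fin n → Fin n → ℤ) → ∑ᶻ₂ f ≡ ∑ᶻ λ u → ∑ᶻ (f u)
  ∑ᶻ₂-unfold f = refl

  ∑-mono : {f g : Fin n → ℕ} → (∀ i → f i ≤ g i) → ∑ f ≤ ∑ g
  ∑-mono {zero}  f≤g = z≤n
  ∑-mono {suc n} f≤g = ℕ.+-mono-≤ (f≤g zero) (∑-mono (f≤g ∘ suc))

  ∑-mono-< : {f g : Fin n → ℕ} → (∀ i → f i ≤ g i) → ∀ j → f j < g j → ∑ f < ∑ g
  ∑-mono-< f≤g zero    lt = ℕ.+-mono-<-≤ lt (∑-mono (f≤g ∘ suc))
  ∑-mono-< f≤g (suc j) lt = ℕ.+-mono-≤-< (f≤g zero) (∑-mono-< (f≤g ∘ suc) j lt)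

  ∑-const : ∀ n c → ∑ {n} (λ _ → c) ≡ n * c
  ∑-const zero    c = refl
  ∑-const (suc n) c = cong (_+_ c) (∑-const n c)

  ∑-bound : {f : Fin n → ℕ} {c : ℕ} → (∀ i → f i ≤ c) → ∑ f ≤ n * c
  ∑-bound {n} {f} {c} f≤c = ℕ.≤-trans (∑-mono f≤c) (ℕ.≤-reflexive (∑-const n c))

  ∑-positive : {f : Fin n → ℕ} (i : Fin n) → 0 < f i → 0 < ∑ f
  ∑-positive i 0<fi = ℕ.≤-<-trans z≤n (∑-mono-< {f = λ _ → 0} (λ _ → z≤n) i 0<fi)

  ∑-zero : {f : Fin n → ℕ} → (∀ i → f i ≡ 0) → ∑ f ≡ 0
  ∑-zero {n} f≡0 = trans (∑-cong f≡0) (trans (∑-const n 0) (ℕ.*-zeroʳ n))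

  ∑-nonzero : (f : Fin n → ℕ) → 0 < ∑ f → ∃ λ i → 0 < f i
  ∑-nonzero {suc n} f pos with f zero in eq
  ... | suc m = zero , subst (0 <_) (sym eq) z<s
  ... | zero  = let i , p = ∑-nonzero (f ∘ suc) pos in suc i , p

  ∑₂-mono : {f g : Fin n → Fin n → ℕ} → (∀ u v → f u v ≤ g u v) → ∑₂ f ≤ ∑₂ g
  ∑₂-mono f≤g = ∑-mono λ u → ∑-mono (f≤g u)

  ∑₂-mono-< : {f g : Fin n → Fin n → ℕ} → (∀ u v → f u v ≤ g u v) →
              ∀ u v → f u v < g u v → ∑₂ f < ∑₂ g
  ∑₂-mono-< f≤g u v lt = ∑-mono-< (λ u → ∑-mono (f≤g u)) u (∑-mono-< (f≤g u) v lt)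

  ∑₂-cong : {f g : Fin n → Fin n → ℕ} → (∀ u v → f u v ≡ g u v) → ∑₂ f ≡ ∑₂ g
  ∑₂-cong f≡g = ∑-cong λ u → ∑-cong (f≡g u)

  ∑₂-+ : (f g : Fin n → Fin n → ℕ) → ∑₂ (λ u v → f u v + g u v) ≡ ∑₂ f + ∑₂ g
  ∑₂-+ f g = trans (∑-cong λ u → ∑-+ (f u) (g u)) (∑-+ (∑ ∘ f) (∑ ∘ g))

  ∑₂-nonzero : (f : Fin n → Fin n → ℕ) → 0 < ∑₂ f → ∃₂ λ u v → 0 < f u v
  ∑₂-nonzero f pos =
    let u , p = ∑-nonzero (∑ ∘ f) pos ; v , q = ∑-nonzero (f u) p in u , v , q

  ∑₂-positive : (f : Fin n → Fin n → ℕ) → ∀ u v → 0 < f u v → 0 < ∑₂ f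
  ∑₂-positive f u v pos = ∑-positive u (∑-positive v pos)

  ∑ᶻ-mono : {f g : Fin n → ℤ} → (∀ i → f i ℤ.≤ g i) → ∑ᶻ f ℤ.≤ ∑ᶻ g
  ∑ᶻ-mono {zero}  f≤g = ℤ.≤-refl
  ∑ᶻ-mono {suc n} f≤g = ℤ.+-mono-≤ (f≤g zero) (∑ᶻ-mono (f≤g ∘ suc))

  ∑ᶻ-pos : (f : Fin n → ℕ) → ∑ᶻ (λ i → int (f i)) ≡ int (∑ f)
  ∑ᶻ-pos {zero}  f = refl
  ∑ᶻ-pos {suc n} f = cong (ℤ._+_ (int (f zero))) (∑ᶻ-pos (f ∘ suc))

  ∑ᶻ-zero : {f : Fin n → ℤ} → (∀ i → f i ≡ ℤ.0ℤ) → ∑ᶻ f ≡ ℤ.0ℤ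
  ∑ᶻ-zero {n} f≡0 =
    trans (∑ᶻ-cong f≡0) (trans (∑ᶻ-pos {n} (λ _ → 0)) (cong int (∑-zero {n} {λ _ → 0} (λ _ → refl))))

  ∑ᶻ-neg : (f : Fin n → ℤ) → ∑ᶻ (λ i → ℤ.- f i) ≡ ℤ.- ∑ᶻ f
  ∑ᶻ-neg {zero}  f = refl
  ∑ᶻ-neg {suc n} f =
    trans (cong (ℤ._+_ (ℤ.- f zero)) (∑ᶻ-neg (f ∘ suc)))
          (sym (ℤ.neg-distrib-+ (f zero) (∑ᶻ (f ∘ suc))))

  ∑ᶻ₂-mono : {f g : Fin n → Fin n → ℤ} → (∀ u v → f u v ℤ.≤ g u v) → ∑ᶻ₂ f ℤ.≤ ∑ᶻ₂ g
  ∑ᶻ₂-mono f≤g = ∑ᶻ-mono λ u → ∑ᶻ-mono (f≤g u)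

  ∑ᶻ₂-cong : {f g : Fin n → Fin n → ℤ} → (∀ u v → f u v ≡ g u v) → ∑ᶻ₂ f ≡ ∑ᶻ₂ g
  ∑ᶻ₂-cong f≡g = ∑ᶻ-cong λ u → ∑ᶻ-cong (f≡g u)

  ∑ᶻ₂-pos : (f : Fin n → Fin n → ℕ) → ∑ᶻ₂ (λ u v → int (f u v)) ≡ int (∑₂ f)
  ∑ᶻ₂-pos f = trans (∑ᶻ-cong λ u → ∑ᶻ-pos (f u)) (∑ᶻ-pos (∑ ∘ f))

  ∑ᶻ₂-+ : (f g : Fin n → Fin n → ℤ) → ∑ᶻ₂ (λ u v → f u v ℤ.+ g u v) ≡ ∑ᶻ₂ f ℤ.+ ∑ᶻ₂ g
  ∑ᶻ₂-+ f g = trans (∑ᶻ-cong λ u → ∑ᶻ-+ (f u) (g u)) (∑ᶻ-+ (∑ᶻ ∘ f) (∑ᶻ ∘ g))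


  ∑ᶻ-δ : (a : Fin n) (x : Fin n → ℤ) → ∑ᶻ (λ v → δ v a ℤ.* x v) ≡ x a
  ∑ᶻ-δ zero x = trans (cong₂ ℤ._+_ (ℤ.*-identityˡ (x zero)) (∑ᶻ-zero λ v → ℤ.*-zeroˡ (x (suc v))))
                      (ℤ.+-identityʳ (x zero))
  ∑ᶻ-δ (suc a) x = trans (cong₂ ℤ._+_ (ℤ.*-zeroˡ (x zero)) (∑ᶻ-δ a (x ∘ suc))) (ℤ.+-identityˡ _)

opaque
  unfolding ∑

  ∑-≟-toℕ≤1 : ∀ n x → ∑ {n} (λ i → 𝟙 (does (x ℕ.≟ toℕ i))) ≤ 1
  ∑-≟-toℕ≤1 zero    x       = z≤n
  ∑-≟-toℕ≤1 (suc n) zero    = ℕ.≤-reflexive (cong suc (∑-zero {n} λ _ → refl))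
  ∑-≟-toℕ≤1 (suc n) (suc x) = ∑-≟-toℕ≤1 n x

  ∑-≟-suc-toℕ≤1 : ∀ n x → ∑ {n} (λ i → 𝟙 (does (x ℕ.≟ suc (toℕ i)))) ≤ 1
  ∑-≟-suc-toℕ≤1 n zero    = ℕ.≤-trans (ℕ.≤-reflexive (∑-zero {n} λ _ → refl)) z≤n
  ∑-≟-suc-toℕ≤1 n (suc x) = ∑-≟-toℕ≤1 n x

∑₂-* : (f g : Fin n → ℕ) → ∑₂ (λ u v → f u * g v) ≡ ∑ f * ∑ g
∑₂-* f g = trans (∑₂-unfold _) (trans (∑-cong λ u → sym (*-∑ (f u) g))
  (trans (∑-cong λ u → ℕ.*-comm (f u) (∑ g)) (trans (sym (*-∑ (∑ g) f)) (ℕ.*-comm (∑ g) (∑ f)))))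

𝟙≤1 : ∀ b → 𝟙 b ≤ 1
𝟙≤1 true  = ℕ.≤-refl
𝟙≤1 false = z≤n

∑-𝟙≤n : (S : Fin n → Bool) → ∑ (𝟙 ∘ S) ≤ n
∑-𝟙≤n {n} S = ℕ.≤-trans (∑-bound (λ i → 𝟙≤1 (S i))) (ℕ.≤-reflexive (ℕ.*-identityʳ n))

-- Query programs

-- Sequencing is a constructor and intermediate results have arbitrary types, so costs and
-- postconditions compose along `_>>=_`; a `QTree` has no place for intermediate results.
data Prog (n : ℕ) : Set → Set₁ where
  ret   : {X : Set} → X → Prog n X
  ask   : VSet n → Prog n ℕ
  _>>=_ : {X Y : Set} → Prog n X → (X → Prog n Y) → Prog n Y

infixl 1 _>>=_

flatten : {X : Set} → Prog n X → (X → QTree n) → QTree n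
flatten (ret x)   k = k x
flatten (ask S)   k = query S k
flatten (p >>= f) k = flatten p λ x → flatten (f x) k

toQTree : Prog n (VSet n) → QTree n
toQTree p = flatten p output

exec : {X : Set} → Graph n → Prog n X → X
exec G (ret x)   = x
exec G (ask S)   = cutSize G S
exec G (p >>= f) = exec G (f (exec G p))

cost : {X : Set} → Graph n → Prog n X → ℕ
cost G (ret x)   = 0
cost G (ask S)   = 1
cost G (p >>= f) = cost G p + cost G (f (exec G p))

run-flatten : (G : Graph n) {X : Set} (p : Prog n X) (k : X → QTree n) →
  proj₁ (run G (flatten p k)) ≡ proj₁ (run G (k (exec G p))) ×
  proj₂ (run G (flatten p k)) ≡ cost G p + proj₂ (run G (k (exec G p)))
run-flatten G (ret x)   k = refl , refl
run-flatten G (ask S)   k = refl , refl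
run-flatten G (p >>= f) k =
  let p₁ , p₂ = run-flatten G p (λ x → flatten (f x) k)
      f₁ , f₂ = run-flatten G (f (exec G p)) k
  in trans p₁ f₁ , trans p₂ (trans (cong (cost G p +_) f₂) (sym (ℕ.+-assoc (cost G p) _ _)))

run-toQTree : (G : Graph n) (p : Prog n (VSet n)) →
  proj₁ (run G (toQTree p)) ≡ exec G p × proj₂ (run G (toQTree p)) ≡ cost G p
run-toQTree G p = let p₁ , p₂ = run-flatten G p output in p₁ , trans p₂ (ℕ.+-identityʳ _)

-- A Hoare triple with a query budget, for one fixed hidden graph.
record Runs {n : ℕ} {X : Set} (G : Graph n) (c : ℕ) (P : X → Set) (p : Prog n X) : Set where
  constructor runs
  field
    within : cost G p ≤ c
    result : P (exec G p)
open Runs public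

module _ {n : ℕ} {G : Graph n} where

  runs-ret : {X : Set} {P : X → Set} {c : ℕ} {x : X} → P x → Runs G c P (ret x)
  runs-ret px = runs z≤n px

  runs-bind : {X Y : Set} {P : X → Set} {Q : Y → Set} {b c : ℕ} {p : Prog n X} {f : X → Prog n Y} →
              Runs G b P p → (∀ x → P x → Runs G c Q (f x)) → Runs G (b + c) Q (p >>= f)
  runs-bind (runs w r) h = runs (ℕ.+-mono-≤ w (within (h _ r))) (result (h _ r))

  runs-weaken : {X : Set} {P Q : X → Set} {b c : ℕ} {p : Prog n X} →
                b ≤ c → (∀ x → P x → Q x) → Runs G b P p → Runs G c Q p
  runs-weaken b≤c P⊆Q (runs w r) = runs (ℕ.≤-trans w b≤c) (P⊆Q _ r)

  runs-toQTree : {P : VSet n → Set} {c : ℕ} (p : Prog n (VSet n)) → Runs G c P p →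
                 proj₂ (run G (toQTree p)) ≤ c × P (proj₁ (run G (toQTree p)))
  runs-toQTree {P} {c} p (runs w r) = let output≡ , cost≡ = run-toQTree G p in
    subst (_≤ c) (sym cost≡) w , subst P (sym output≡) r

module _ {n : ℕ} {X Y : Set} (step : X → Prog n (X ⊎ Y)) (giveUp : X → Y) where

  loop : ℕ → X → Prog n Y
  loop zero    x = ret (giveUp x)
  loop (suc m) x = step x >>= λ { (inj₁ x′) → loop m x′ ; (inj₂ y) → ret y }

  module _ {G : Graph n} {c B : ℕ} {Inv : X → Set} {Post : Y → Set} (Φ : X → ℕ) where

    StepPost : X → X ⊎ Y → Set
    StepPost x (inj₁ x′) = Inv x′ × Φ x < Φ x′
    StepPost x (inj₂ y)  = Post y

    -- The potential bounds the number of steps, so giveUp is never reached.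
    runs-loop : (∀ x → Inv x → Φ x ≤ B) → (∀ x → Inv x → Runs G c (StepPost x) (step x)) →
                ∀ m x → Inv x → B < m + Φ x → Runs G (m * c) Post (loop m x)
    runs-loop bounded runs-step zero x inv B<Φ = contradiction (bounded x inv) (ℕ.<⇒≱ B<Φ)
    runs-loop bounded runs-step (suc m) x inv B<m+Φ = runs-bind (runs-step x inv) λ
      { (inj₁ x′) (inv′ , Φ<) → runs-loop bounded runs-step m x′ inv′
          (ℕ.<-≤-trans B<m+Φ (ℕ.≤-trans (ℕ.≤-reflexive (sym (ℕ.+-suc m (Φ x)))) (ℕ.+-monoʳ-≤ m Φ<)))
      ; (inj₂ y) post → runs-ret post }

-- Locating hidden edges with cut queries

allBool? : {P : Bool → Set} → (∀ b → Dec (P b)) → Dec (∀ b → P b)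
allBool? P? = map′ (λ { (p , q) true → p ; (p , q) false → q }) (λ h → h true , h false)
                   (P? true ×-dec P? false)

Rel₂ : ℕ → Set
Rel₂ n = Fin n → Fin n → Bool

between : VSet n → VSet n → Rel₂ n
between A B u v = A u ∧ B v ∨ B u ∧ A v

cutSize-∑₂ : (G : Graph n) (S : VSet n) → cutSize G S ≡ ∑₂ (λ u v → 𝟙 (S u ∧ not (S v) ∧ adj G u v))
cutSize-∑₂ G S = trans (sumFin≡∑ _) (trans (∑-cong λ u → sumFin≡∑ _) (sym (∑₂-unfold _)))

_⊆ᴳ_ : Rel₂ n → Graph n → Set
K ⊆ᴳ G = ∀ {u v} → K u v ≡ true → adj G u v ≡ true

Hidden : Graph n → Rel₂ n → Fin n → Fin n → Set
Hidden G K u v = adj G u v ≡ true × K u v ≡ false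

HiddenBetween : Graph n → Rel₂ n → VSet n → VSet n → Set
HiddenBetween G K A B = ∃₂ λ u v → A u ≡ true × B v ≡ true × Hidden G K u v

-- For disjoint sets, the cuts of `A` and `B` minus the cut of their union count every edge between
-- them twice. `between` is symmetric, so the sum over ordered pairs counts the known ones twice as
-- well, and a strict inequality betrays a hidden edge.
anyHidden : Rel₂ n → VSet n → VSet n → Prog n Bool
anyHidden K A B =
  ask A >>= λ a → ask B >>= λ b → ask (λ u → A u ∨ B u) >>= λ c →
  ret (does (c + ∑₂ (λ u v → 𝟙 (between A B u v ∧ K u v)) <? a + b))

Decides : Set → Bool → Set
Decides P b = (b ≡ true × P) ⊎ (b ≡ false × ¬ P)

decides-does : {P Q : Set} (d : Dec P) → (P → Q) → (Q → P) → Decides Q (does d)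
decides-does (yes p) f g = inj₁ (refl , f p)
decides-does (no ¬p) f g = inj₂ (refl , ¬p ∘ g)

∧-true : ∀ {a b} → a ∧ b ≡ true → a ≡ true × b ≡ true
∧-true {true} {true} _ = refl , refl

∨-true : ∀ {a b} → a ∨ b ≡ true → a ≡ true ⊎ b ≡ true
∨-true {true}  _ = inj₁ refl
∨-true {false} p = inj₂ p

𝟙-pos : ∀ {b} → 0 < 𝟙 b → b ≡ true
𝟙-pos {true} _ = refl

module _ {n : ℕ} {G : Graph n} {K : Rel₂ n} (K-sym : ∀ u v → K u v ≡ K v u) (K⊆G : K ⊆ᴳ G) where

  module _ {A B : VSet n} (disjoint : ∀ {u} → A u ≡ true → B u ≡ false) where

    private
      hidden : ℕ
      hidden = ∑₂ λ u v → 𝟙 (between A B u v ∧ adj G u v ∧ not (K u v))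
      known : ℕ
      known = ∑₂ λ u v → 𝟙 (between A B u v ∧ K u v)

      Split : (a a′ b b′ e k : Bool) → Set
      Split a a′ b b′ e k = (a ≡ true → b ≡ false) → (a′ ≡ true → b′ ≡ false) → (k ≡ true → e ≡ true) →
        𝟙 (a ∧ not a′ ∧ e) + 𝟙 (b ∧ not b′ ∧ e) ≡
        𝟙 ((a ∨ b) ∧ not (a′ ∨ b′) ∧ e) + 𝟙 ((a ∧ b′ ∨ b ∧ a′) ∧ k) + 𝟙 ((a ∧ b′ ∨ b ∧ a′) ∧ e ∧ not k)

      -- The counting identity already holds for each ordered pair of vertices, so it is decided by
      -- running through all 64 membership patterns.
      split? : Dec (∀ a a′ b b′ e k → Split a a′ b b′ e k)
      split? = allBool? λ a → allBool? λ a′ → allBool? λ b → allBool? λ b′ → allBool? λ e → allBool? λ k →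
        ((a Bool.≟ true) →-dec (b Bool.≟ false)) →-dec
        (((a′ Bool.≟ true) →-dec (b′ Bool.≟ false)) →-dec
        (((k Bool.≟ true) →-dec (e Bool.≟ true)) →-dec (_ ℕ.≟ _)))

      count : cutSize G A + cutSize G B ≡ cutSize G (λ u → A u ∨ B u) + known + hidden
      count = begin
        cutSize G A + cutSize G B
          ≡⟨ cong₂ _+_ (cutSize-∑₂ G A) (cutSize-∑₂ G B) ⟩
        _ ≡⟨ ∑₂-+ _ _ ⟨
        _ ≡⟨ ∑₂-cong (λ u v → from-yes split? (A u) (A v) (B u) (B v) (adj G u v) (K u v) disjoint disjoint K⊆G) ⟩
        _ ≡⟨ ∑₂-+ _ _ ⟩
        _ ≡⟨ cong (_+ hidden) (∑₂-+ _ _) ⟩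
        _ ≡⟨ cong (λ x → x + known + hidden) (cutSize-∑₂ G (λ u → A u ∨ B u)) ⟨
        _ ∎
        where open ≡-Reasoning

      found : 0 < hidden → HiddenBetween G K A B
      found pos with ∑₂-nonzero _ pos
      ... | u , v , p with ∧-true {between A B u v} (𝟙-pos p)
      ... | AB , q with ∧-true {adj G u v} q | ∨-true {A u ∧ B v} AB
      ... | e , k | inj₁ c = let Au , Bv = ∧-true c in u , v , Au , Bv , e , Bool.not-injective k
      ... | e , k | inj₂ c = let Bu , Av = ∧-true c in
        v , u , Av , Bu , trans (adj-sym G v u) e , trans (K-sym v u) (Bool.not-injective k)

      counted : HiddenBetween G K A B → 0 < hidden
      counted (u , v , Au , Bv , e , k) = ∑₂-positive _ u v (ℕ.≤-reflexive (sym
        (cong 𝟙 (trans (cong₂ (λ x y → (x ∧ y ∨ B u ∧ A v) ∧ adj G u v ∧ not (K u v)) Au Bv)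
                       (cong₂ (λ x y → x ∧ not y) e k)))))

    runs-anyHidden : Runs G 3 (Decides (HiddenBetween G K A B)) (anyHidden K A B)
    runs-anyHidden = runs ℕ.≤-refl (decides-does (_ <? _)
      (λ lt → found (ℕ.+-cancelˡ-< _ 0 _ (subst₂ _<_ (sym (ℕ.+-identityʳ _)) count lt)))
      (λ h → subst₂ _<_ (ℕ.+-identityʳ _) (sym count) (ℕ.+-monoʳ-< _ (counted h))))

vertexAt : Fin n → ℕ → Fin n
vertexAt {n} default i with i <? n
... | yes i<n = fromℕ< i<n
... | no _    = default

vertexAt-toℕ : (default x : Fin n) → vertexAt default (toℕ x) ≡ x
vertexAt-toℕ {n} default x with toℕ x <? n
... | yes lt = Fin.fromℕ<-toℕ x lt
... | no ≮  = contradiction (Fin.toℕ<n x) ≮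

window : VSet n → ℕ → ℕ → VSet n
window X lo L u = X u ∧ does (lo ≤? toℕ u) ∧ does (toℕ u <? lo + 2 ^ L)

does-true : {P : Set} (d : Dec P) → does d ≡ true → P
does-true (yes p) _ = p

true-does : {P : Set} (d : Dec P) → P → does d ≡ true
true-does (yes _) _ = refl
true-does (no ¬p) p = contradiction p ¬p

module _ {n : ℕ} (default : Fin n) (test : VSet n → Prog n Bool) (X : VSet n) where

  search : ℕ → ℕ → Prog n (Fin n)
  search zero    lo = ret (vertexAt default lo)
  search (suc L) lo = test (window X lo L) >>= λ b → if b then search L lo else search L (lo + 2 ^ L)

  module _ {G : Graph n} {c : ℕ} {Good : Fin n → Set}
    (runs-test : ∀ Y → (∀ {u} → Y u ≡ true → X u ≡ true) →
                 Runs G c (Decides (∃ λ u → Y u ≡ true × Good u)) (test Y)) where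

    -- Binary search over vertex indices. If the lower half passes the test, its witness replaces
    -- `u`; if it fails, `u` itself must lie in the upper half. At `L = 0` the window is the single
    -- index `lo`.
    runs-search : ∀ L lo u → X u ≡ true → Good u → lo ≤ toℕ u → toℕ u < lo + 2 ^ L →
                  Runs G (L * c) (λ w → X w ≡ true × Good w) (search L lo)
    runs-search zero lo u Xu good lo≤ <hi = runs-ret (subst (λ w → X w ≡ true × Good w) u≡ (Xu , good))
      where
      u≡ : u ≡ vertexAt default lo
      u≡ = trans (sym (vertexAt-toℕ default u)) (cong (vertexAt default)
             (ℕ.≤-antisym (ℕ.≤-pred (subst (suc (toℕ u) ≤_) (ℕ.+-comm lo 1) <hi)) lo≤))
    runs-search (suc L) lo u Xu good lo≤ <hi = runs-bind
      (runs-test (window X lo L) (proj₁ ∘ ∧-true)) λ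
      { true (inj₁ (_ , w , inW , goodW)) →
          let Xw , r = ∧-true inW ; r₁ , r₂ = ∧-true r
          in runs-search L lo w Xw goodW (does-true (_ ≤? _) r₁) (does-true (_ <? _) r₂)
      ; false (inj₂ (_ , none)) → runs-search L (lo + 2 ^ L) u Xu good
          (ℕ.≮⇒≥ λ lt → none (u , cong₂ _∧_ Xu (cong₂ _∧_ (true-does (_ ≤? _) lo≤) (true-does (_ <? _) lt)) , good))
          (subst (toℕ u <_) (trans (cong (λ x → lo + (2 ^ L + x)) (ℕ.+-identityʳ (2 ^ L))) (sym (ℕ.+-assoc lo (2 ^ L) (2 ^ L)))) <hi) }

n<2^1+log : ∀ n → n < 2 ^ (⌊log₂ n ⌋ + 1)
n<2^1+log n with n <? 2 ^ (⌊log₂ n ⌋ + 1)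
... | yes lt = lt
... | no ≮  = contradiction
  (subst (_≤ ⌊log₂ n ⌋) (trans (⌊log₂[2^n]⌋≡n (⌊log₂ n ⌋ + 1)) (ℕ.+-comm ⌊log₂ n ⌋ 1)) (⌊log₂⌋-mono-≤ (ℕ.≮⇒≥ ≮)))
  (ℕ.<-irrefl refl)

-- One emptiness test and two binary searches of depth ⌊log₂ n⌋ + 1, at three queries per test; the
-- depth is at least 1, so the first test costs at most three times the depth.
searchCost : ℕ → ℕ
searchCost n = 9 * (⌊log₂ n ⌋ + 1)

module _ {n : ℕ} (default : Fin n) (K : Rel₂ n) (A B : VSet n) where

  private
    depth : ℕ
    depth = ⌊log₂ n ⌋ + 1

  -- The endpoints are found one after the other: first a `u` in `A` with some hidden edge to `B`,
  -- then a partner of this `u`, with `A` shrunk to the singleton of `u`.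
  findHidden : Prog n (Maybe (Fin n × Fin n))
  findHidden = anyHidden K A B >>= λ b → if b
    then (search default (λ A′ → anyHidden K A′ B) A depth 0 >>= λ u →
          search default (λ B′ → anyHidden K (u ==_) B′) B depth 0 >>= λ v →
          ret (just (u , v)))
    else ret nothing

  FindPost : Graph n → Maybe (Fin n × Fin n) → Set
  FindPost G (just (u , v)) = A u ≡ true × B v ≡ true × Hidden G K u v
  FindPost G nothing        = ¬ HiddenBetween G K A B

  runs-findHidden : {G : Graph n} → (∀ u v → K u v ≡ K v u) → K ⊆ᴳ G →
    (∀ {u} → A u ≡ true → B u ≡ false) → Runs G (searchCost n) (FindPost G) findHidden
  runs-findHidden {G} K-sym K⊆G disjoint = runs-weaken cost≤ (λ _ p → p)
    (runs-bind (runs-anyHidden K-sym K⊆G disjoint) λ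
      { false (inj₂ (_ , none)) → runs-ret none
      ; true (inj₁ (_ , u₀ , v₀ , Au₀ , Bv₀ , hid₀)) →
        runs-bind (runs-search default _ A testA depth 0 u₀ Au₀ (v₀ , Bv₀ , hid₀) z≤n (small u₀)) λ
          { u (Au , v₁ , Bv₁ , hid₁) →
            runs-bind {c = 0}
              (runs-search default _ B (testB u Au) depth 0 v₁ Bv₁ hid₁ z≤n (small v₁)) λ
              { v (Bv , hid) → runs-ret (Au , Bv , hid) } } })
    where
    small : (u : Fin n) → toℕ u < 2 ^ depth
    small u = ℕ.<-trans (Fin.toℕ<n u) (n<2^1+log n)
    linear : ∀ l → 3 + ((1 + l) * 3 + ((1 + l) * 3 + 0)) ≤ 9 * (1 + l)
    linear l = ℕ.≤-trans (ℕ.m≤m+n _ (3 * l)) (ℕ.≤-reflexive (identity l))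
      where
      identity : ∀ l → 3 + ((1 + l) * 3 + ((1 + l) * 3 + 0)) + 3 * l ≡ 9 * (1 + l)
      identity = solve-∀
    cost≤ : 3 + (depth * 3 + (depth * 3 + 0)) ≤ 9 * depth
    cost≤ = subst (λ x → 3 + (x * 3 + (x * 3 + 0)) ≤ 9 * x) (ℕ.+-comm 1 ⌊log₂ n ⌋)
              (linear ⌊log₂ n ⌋)
    decides : {P Q : Set} → (P → Q) → (Q → P) → ∀ b → Decides P b → Decides Q b
    decides f g b (inj₁ (e , p)) = inj₁ (e , f p)
    decides f g b (inj₂ (e , p)) = inj₂ (e , p ∘ g)
    testA : ∀ Y → (∀ {u} → Y u ≡ true → A u ≡ true) →
            Runs G 3 (Decides (∃ λ u → Y u ≡ true × ∃ λ v → B v ≡ true × Hidden G K u v)) (anyHidden K Y B)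
    testA Y Y⊆A = runs-weaken ℕ.≤-refl
      (decides (λ { (u , v , a , b , h) → u , a , v , b , h }) (λ { (u , a , v , b , h) → u , v , a , b , h }))
      (runs-anyHidden K-sym K⊆G (disjoint ∘ Y⊆A))
    testB : ∀ u → A u ≡ true → ∀ Y → (∀ {v} → Y v ≡ true → B v ≡ true) →
            Runs G 3 (Decides (∃ λ v → Y v ≡ true × Hidden G K u v)) (anyHidden K (u ==_) Y)
    testB u Au Y Y⊆B = runs-weaken ℕ.≤-refl
      (decides (λ { (u′ , v , a , b , h) → v , b , subst (λ x → Hidden G K x v) (sym (does-true (u Fin.≟ u′) a)) h })
               (λ { (v , b , h) → u , v , ==-refl u , b , h }))
      (runs-anyHidden K-sym K⊆G λ {w} w≡u →
        Bool.¬-not λ Yw → Bool.not-¬ (disjoint (subst (λ x → A x ≡ true) (does-true (u Fin.≟ w) w≡u) Au)) (Y⊆B Yw))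

-- Flows and reachability

-- The value is an integer of any sign and the terminals may coincide, so that flows, single arcs,
-- paths, cycles and differences of flows are all instances and can be added.
record Circ {n : ℕ} (s t : Fin n) (r : ℤ) (f : Fin n → Fin n → ℤ) : Set where
  field
    skew : ∀ u v → f v u ≡ ℤ.- f u v
    div  : ∀ u → ∑ᶻ (f u) ≡ r ℤ.* (δ u s ℤ.- δ u t)
open Circ public

module _ {n : ℕ} where

  private
    V : Set
    V = Fin n
    variable
      f g : V → V → ℤ
      s t u v w x : V
      q r : ℤ

  circ-+ : Circ s t q f → Circ s t r g → Circ s t (q ℤ.+ r) (λ u v → f u v ℤ.+ g u v)
  circ-+ {s} {t} {q} {f} {r} {g} F G .skew u v =
    trans (cong₂ ℤ._+_ (skew F u v) (skew G u v)) (sym (ℤ.neg-distrib-+ (f u v) (g u v)))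
  circ-+ {s} {t} {q} {f} {r} {g} F G .div u =
    trans (∑ᶻ-+ (f u) (g u)) (trans (cong₂ ℤ._+_ (div F u) (div G u))
      (sym (ℤ.*-distribʳ-+ (δ u s ℤ.- δ u t) q r)))

  circ-neg : Circ s t r f → Circ s t (ℤ.- r) (λ u v → ℤ.- f u v)
  circ-neg F .skew u v = cong ℤ.-_ (skew F u v)
  circ-neg {r = r} {f = f} F .div u =
    trans (∑ᶻ-neg (f u)) (trans (cong ℤ.-_ (div F u)) (ℤ.neg-distribˡ-* r _))

  circ-trans : Circ u v r f → Circ v w r g → Circ u w r (λ a b → f a b ℤ.+ g a b)
  circ-trans {f = f} {g = g} F G .skew a b =
    trans (cong₂ ℤ._+_ (skew F a b) (skew G a b)) (sym (ℤ.neg-distrib-+ (f a b) (g a b)))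
  circ-trans {u} {v} {r} {f} {w} {g} F G .div a =
    trans (∑ᶻ-+ (f a) (g a)) (trans (cong₂ ℤ._+_ (div F a) (div G a)) (telescope r (δ a u) (δ a v) (δ a w)))
    where
    telescope : ∀ r x y z → r ℤ.* (x ℤ.- y) ℤ.+ r ℤ.* (y ℤ.- z) ≡ r ℤ.* (x ℤ.- z)
    telescope = solveᶻ-∀

  circ-loop : Circ u u r f → Circ s t 0ℤ f
  circ-loop F .skew = skew F
  circ-loop {u} {r} {f} {s} {t} F .div a = trans (div F a) (cancel r (δ a u) (δ a s ℤ.- δ a t))
    where
    cancel : ∀ r x y → r ℤ.* (x ℤ.- x) ≡ 0ℤ ℤ.* y
    cancel = solveᶻ-∀

  circ-zero : Circ u u r (λ _ _ → 0ℤ)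
  circ-zero .skew a b = refl
  circ-zero {u} {r} .div a = trans (∑ᶻ-zero {f = λ _ → 0ℤ} λ _ → refl) (cancel r (δ a u))
    where
    cancel : ∀ r x → 0ℤ ≡ r ℤ.* (x ℤ.- x)
    cancel = solveᶻ-∀

  arc : V → V → V → V → ℤ
  arc a b u v = δ v b ℤ.* δ u a ℤ.- δ v a ℤ.* δ u b

  arc-circ : ∀ a b → Circ a b 1ℤ (arc a b)
  arc-circ a b .skew u v = anti (δ u a) (δ u b) (δ v a) (δ v b)
    where
    anti : ∀ w x y z → x ℤ.* y ℤ.- w ℤ.* z ≡ ℤ.- (z ℤ.* w ℤ.- y ℤ.* x)
    anti = solveᶻ-∀
  arc-circ a b .div u = trans (∑ᶻ-+ _ _) (trans
    (cong₂ ℤ._+_ (∑ᶻ-δ b (λ _ → δ u a)) (trans (∑ᶻ-neg _) (cong ℤ.-_ (∑ᶻ-δ a (λ _ → δ u b)))))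
    (sym (ℤ.*-identityˡ _)))

  private
    -∙≤0 : ∀ x y → 0ℤ ℤ.- (int (𝟙 x) ℤ.* int (𝟙 y)) ℤ.≤ 0ℤ
    -∙≤0 true  true  = ℤ.-≤+
    -∙≤0 true  false = ℤ.≤-refl
    -∙≤0 false y     = ℤ.≤-refl

  arc≤0 : ∀ {a b} → ¬ (a ≡ u × b ≡ v) → arc u v a b ℤ.≤ 0ℤ
  arc≤0 {u} {v} {a} {b} ¬uv with a Fin.≟ u | b Fin.≟ v
  ... | yes p | yes q = contradiction (p , q) ¬uv
  ... | no _  | yes _ = -∙≤0 (b == u) (a == v)
  ... | yes _ | no _  = -∙≤0 (b == u) (a == v)
  ... | no _  | no _  = -∙≤0 (b == u) (a == v)

  arc-self : u ≢ v → arc u v u v ≡ 1ℤ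
  arc-self {u} {v} u≢v rewrite ==-refl u | ==-refl v | ==-≢ u≢v | ==-≢ (u≢v ∘ sym) = refl

  -- Summation by parts; weak and strong duality, the effect of level cuts and the
  -- bound on the support of acyclic flows are all instances.
  potential-identity : Circ s t r f → (p : V → ℤ) →
    ∑ᶻ₂ (λ u v → f u v ℤ.* (p u ℤ.- p v)) ≡ r ℤ.* (p s ℤ.- p t) ℤ.+ r ℤ.* (p s ℤ.- p t)
  potential-identity {s} {t} {r} {f} F p = begin
    ∑ᶻ₂ (λ u v → f u v ℤ.* (p u ℤ.- p v))
      ≡⟨ ∑ᶻ₂-cong (λ u v → trans (expand (f u v) (p u) (p v))
           (cong (λ x → p u ℤ.* f u v ℤ.+ p v ℤ.* x) (sym (skew F u v)))) ⟩
    ∑ᶻ₂ (λ u v → p u ℤ.* f u v ℤ.+ p v ℤ.* f v u)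
      ≡⟨ ∑ᶻ₂-+ (λ u v → p u ℤ.* f u v) (λ u v → p v ℤ.* f v u) ⟩
    ∑ᶻ₂ (λ u v → p u ℤ.* f u v) ℤ.+ ∑ᶻ₂ (λ u v → p v ℤ.* f v u)
      ≡⟨ cong (ℤ._+_ (∑ᶻ₂ (λ u v → p u ℤ.* f u v))) (∑ᶻ₂-swap (λ u v → p v ℤ.* f v u)) ⟩
    ∑ᶻ₂ (λ u v → p u ℤ.* f u v) ℤ.+ ∑ᶻ₂ (λ u v → p u ℤ.* f u v)
      ≡⟨ cong₂ ℤ._+_ total total ⟩
    r ℤ.* (p s ℤ.- p t) ℤ.+ r ℤ.* (p s ℤ.- p t) ∎
    where
    open ≡-Reasoning
    expand : ∀ x a b → x ℤ.* (a ℤ.- b) ≡ a ℤ.* x ℤ.+ b ℤ.* (ℤ.- x)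
    expand = solveᶻ-∀
    regroup : ∀ a r x y → a ℤ.* (r ℤ.* (x ℤ.- y)) ≡ x ℤ.* (r ℤ.* a) ℤ.+ (ℤ.- (y ℤ.* (r ℤ.* a)))
    regroup = solveᶻ-∀
    factor : ∀ r x y → r ℤ.* x ℤ.+ (ℤ.- (r ℤ.* y)) ≡ r ℤ.* (x ℤ.- y)
    factor = solveᶻ-∀
    total : ∑ᶻ₂ (λ u v → p u ℤ.* f u v) ≡ r ℤ.* (p s ℤ.- p t)
    total = begin
      ∑ᶻ₂ (λ u v → p u ℤ.* f u v)
        ≡⟨ ∑ᶻ₂-unfold _ ⟩
      ∑ᶻ (λ u → ∑ᶻ (λ v → p u ℤ.* f u v))
        ≡⟨ ∑ᶻ-cong (λ u → trans (sym (*-∑ᶻ (p u) (f u))) (trans (cong (p u ℤ.*_) (div F u))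
             (regroup (p u) r (δ u s) (δ u t)))) ⟩
      ∑ᶻ (λ u → δ u s ℤ.* (r ℤ.* p u) ℤ.+ (ℤ.- (δ u t ℤ.* (r ℤ.* p u))))
        ≡⟨ trans (∑ᶻ-+ _ _) (cong₂ ℤ._+_ (∑ᶻ-δ s (λ u → r ℤ.* p u))
             (trans (∑ᶻ-neg _) (cong ℤ.-_ (∑ᶻ-δ t (λ u → r ℤ.* p u))))) ⟩
      r ℤ.* p s ℤ.+ (ℤ.- (r ℤ.* p t))
        ≡⟨ factor r (p s) (p t) ⟩
      r ℤ.* (p s ℤ.- p t) ∎

  -- The strict descent of `ρ` makes every path simple by construction. It serves both breadth-first
  -- distances and the level labels of the short-augmentation phase.
  data Path (P : V → V → Set) (ρ : V → ℕ) : V → V → Set where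
    []  : Path P ρ u u
    hop : P u v → ρ v < ρ u → Path P ρ v w → Path P ρ u w

  module _ {P : V → V → Set} {ρ : V → ℕ} where

    length : Path P ρ u w → ℕ
    length []          = 0
    length (hop _ _ p) = suc (length p)

    path-descends : Path P ρ u w → ρ w ≤ ρ u
    path-descends []           = ℕ.≤-refl
    path-descends (hop _ lt p) = ℕ.≤-trans (path-descends p) (ℕ.<⇒≤ lt)

    length-bound : (p : Path P ρ u w) → length p ≤ ρ u
    length-bound []           = z≤n
    length-bound (hop _ lt p) = ℕ.≤-<-trans (length-bound p) lt

    pathFlow : Path P ρ u w → V → V → ℤ
    pathFlow []                          a b = 0ℤ
    pathFlow (hop {u} {v} _ _ p) a b = arc u v a b ℤ.+ pathFlow p a b

    pathFlow-circ : (p : Path P ρ u w) → Circ u w 1ℤ (pathFlow p)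
    pathFlow-circ []          = circ-zero
    pathFlow-circ (hop _ _ p) = circ-trans (arc-circ _ _) (pathFlow-circ p)

    pathFlow-above : (p : Path P ρ u w) → ρ u < ρ x → ∀ y → pathFlow p x y ≡ 0ℤ
    pathFlow-above [] _ y = refl
    pathFlow-above {x = x} (hop {u} {v} _ v<u p) u<x y
      rewrite ==-≢ {u = x} {u} (λ { refl → ℕ.<-irrefl refl u<x })
            | ==-≢ {u = x} {v} (λ { refl → ℕ.<-asym v<u u<x })
            | pathFlow-above {x = x} p (ℕ.<-trans v<u u<x) y
            | ℤ.*-zeroʳ (δ y v) | ℤ.*-zeroʳ (δ y u) = refl

    -- The tail of a path starts below `u` and so contributes nothing to the row of `u`; the first
    -- arc is therefore used exactly once. On any other pair that arc adds zero or a negative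
    -- amount.
    pathFlow-bound : (p : Path P ρ u w) → ∀ a b →
      pathFlow p a b ℤ.≤ 0ℤ ⊎ (pathFlow p a b ℤ.≤ 1ℤ × P a b × ρ b < ρ a)
    pathFlow-bound [] a b = inj₁ ℤ.≤-refl
    pathFlow-bound (hop {u} {v} Puv v<u p) a b with (a Fin.≟ u) ×-dec (b Fin.≟ v)
    ... | yes (refl , refl)
      rewrite arc-self {u} {v} (λ { refl → ℕ.<-irrefl refl v<u }) | pathFlow-above p v<u v = inj₂ (ℤ.≤-refl , Puv , v<u)
    ... | no ¬uv with pathFlow-bound p a b
    ... | inj₁ p≤0 = inj₁ (ℤ.+-mono-≤ (arc≤0 ¬uv) p≤0)
    ... | inj₂ (p≤1 , Pab , b<a) = inj₂ (ℤ.+-mono-≤ (arc≤0 ¬uv) p≤1 , Pab , b<a)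

  module Reachability (P : V → V → Bool) (w : V) where

    private
      step? : (R : V → Bool) (u : V) → Dec (∃ λ v → P u v ≡ true × R v ≡ true)
      step? R u = Fin.any? λ v → (P u v Bool.≟ true) ×-dec (R v Bool.≟ true)

      within-steps : ℕ → V → Bool
      within-steps zero    u = u == w
      within-steps (suc i) u = within-steps i u ∨ does (step? (within-steps i) u)

      mono₁ : ∀ i → within-steps i u ≡ true → within-steps (suc i) u ≡ true
      mono₁ {u} i r = cong (_∨ does (step? (within-steps i) u)) r

      mono : ∀ {i j} → i ≤′ j → within-steps i u ≡ true → within-steps j u ≡ true
      mono (≤′-reflexive refl) r = r
      mono (≤′-step {j} i≤j) r = mono₁ j (mono i≤j r)

      grow : ∀ i → P u v ≡ true → within-steps i v ≡ true → within-steps (suc i) u ≡ true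
      grow {u} {v} i Puv r = trans (cong (within-steps i u ∨_) (true-does (step? (within-steps i) u) (v , Puv , r)))
                                   (Bool.∨-zeroʳ (within-steps i u))

      Stable : ℕ → Set
      Stable i = ∀ u → within-steps (suc i) u ≡ true → within-steps i u ≡ true

      stable-suc : ∀ i → Stable i → Stable (suc i)
      stable-suc i stable u r with ∨-true {within-steps (suc i) u} r
      ... | inj₁ r₁ = r₁
      ... | inj₂ r₂ with does-true (step? (within-steps (suc i)) u) r₂
      ... | v , Puv , rv = grow i Puv (stable v rv)

      -- Each round that is not stable adds a vertex. After `n` rounds the second alternative would
      -- require more than `n` vertices.
      stable⊎large : ∀ i → Stable i ⊎ i < ∑ (𝟙 ∘ within-steps i)
      stable⊎large zero = inj₂ (∑-positive w (subst (λ b → 0 < 𝟙 b) (sym (==-refl w)) ℕ.≤-refl))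
      stable⊎large (suc i) with stable⊎large i
      ... | inj₁ stable = inj₁ (stable-suc i stable)
      ... | inj₂ large with Fin.any? (λ u → (within-steps (suc i) u Bool.≟ true) ×-dec (within-steps i u Bool.≟ false))
      ... | no none = inj₁ (stable-suc i λ u r → Bool.¬-not λ e → none (u , r , e))
      ... | yes (u , new , old) = inj₂ (ℕ.≤-<-trans large (∑-mono-< 𝟙-mono u
              (subst₂ (λ a b → 𝟙 a < 𝟙 b) (sym old) (sym new) ℕ.≤-refl)))
        where
        𝟙-mono : ∀ u → 𝟙 (within-steps i u) ≤ 𝟙 (within-steps (suc i) u)
        𝟙-mono u with within-steps i u in e
        ... | false = z≤n
        ... | true  = ℕ.≤-refl

    reaches : V → Bool
    reaches = within-steps n

    reaches-self : reaches w ≡ true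
    reaches-self = mono {w} {0} {n} (ℕ.≤⇒≤′ z≤n) (==-refl w)

    reaches-step : P u v ≡ true → reaches v ≡ true → reaches u ≡ true
    reaches-step {u} Puv r with stable⊎large n
    ... | inj₁ stable = stable u (grow n Puv r)
    ... | inj₂ large  = contradiction (∑-𝟙≤n reaches) (ℕ.<⇒≱ large)

    -- Breadth-first distance in unary: the number of rounds among the first `n` after which `u` is
    -- still missing.
    distance : V → ℕ
    distance u = ∑ {n} λ j → 𝟙 (not (within-steps (toℕ j) u))

    private
      distance-< : ∀ i → i < n → within-steps i u ≡ false → within-steps i v ≡ true → distance v < distance u
      distance-< {u} {v} i i<n far near = ∑-mono-< pointwise (fromℕ< i<n)
        (subst (λ k → 𝟙 (not (within-steps k v)) < 𝟙 (not (within-steps k u))) (sym (Fin.toℕ-fromℕ< i<n))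
          (subst₂ (λ a b → 𝟙 (not a) < 𝟙 (not b)) (sym near) (sym far) ℕ.≤-refl))
        where
        pointwise : ∀ j → 𝟙 (not (within-steps (toℕ j) v)) ≤ 𝟙 (not (within-steps (toℕ j) u))
        pointwise j with within-steps (toℕ j) v in ev | within-steps (toℕ j) u in eu
        ... | true  | _     = z≤n
        ... | false | false = ℕ.≤-refl
        ... | false | true with ℕ.≤-total i (toℕ j)
        ... | inj₁ i≤j = contradiction (trans (sym ev) (mono (ℕ.≤⇒≤′ i≤j) near)) λ ()
        ... | inj₂ j≤i = contradiction (trans (sym far) (mono (ℕ.≤⇒≤′ j≤i) eu)) λ ()

      path′ : ∀ i → i ≤ n → within-steps i u ≡ true → Path (λ a b → P a b ≡ true) distance u w
      path′ {u} zero _ r = subst (Path _ _ u) (does-true (u Fin.≟ w) r) []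
      path′ {u} (suc i) i<n r with within-steps i u in e
      ... | true = path′ i (ℕ.<⇒≤ i<n) e
      ... | false with does-true (step? (within-steps i) u) r
      ... | v , Puv , rv = hop Puv (distance-< i i<n e rv) (path′ i (ℕ.<⇒≤ i<n) rv)

    path : reaches u ≡ true → Path (λ a b → P a b ≡ true) distance u w
    path = path′ n ℕ.≤-refl

    reaches-least : (X : V → Set) → X w → (∀ {u v} → P u v ≡ true → X v → X u) →
                    reaches u ≡ true → X u
    reaches-least X Xw closed r = along (path r)
      where
      along : ∀ {u} → Path (λ a b → P a b ≡ true) distance u w → X u
      along []          = Xw
      along (hop e _ p) = closed e (along p)

-- Cut duality and acyclic flows

-- Sums over ordered pairs see each edge in both orientations, so the duality statements first
-- appear doubled.
m+m≤n+n⇒m≤n : ∀ {m n} → m + m ≤ n + n → m ≤ n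
m+m≤n+n⇒m≤n {m} {n} le = ℕ.≮⇒≥ λ n<m → ℕ.<⇒≱ (ℕ.+-mono-< n<m n<m) le

_⊆ᴷ_ : {n : ℕ} → Rel₂ n → Rel₂ n → Set
K ⊆ᴷ K′ = ∀ {u v} → K u v ≡ true → K′ u v ≡ true

𝟙-mono : ∀ {a b} → (a ≡ true → b ≡ true) → 𝟙 a ≤ 𝟙 b
𝟙-mono {false} h = z≤n
𝟙-mono {true}  h rewrite h refl = ℕ.≤-refl

module Flows {n : ℕ} (s t : Fin n) where

  private
    V : Set
    V = Fin n
    variable
      a b : ℕ
      f f₀ : V → V → ℤ
      K K′ K₀ : Rel₂ n
      ρ : V → ℕ

  -- An undirected edge has capacity one in each direction. For symmetric `K`, skew symmetry bounds
  -- the flow on an edge below by -1 and forces it to be zero off `K`.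
  record Flow (K : Rel₂ n) (f : V → V → ℤ) (a : ℕ) : Set where
    field
      circ : Circ s t (int a) f
      cap  : ∀ u v → f u v ℤ.≤ int (𝟙 (K u v))
  open Flow public

  Residual : Rel₂ n → (V → V → ℤ) → V → V → Set
  Residual K f u v = f u v ℤ.< int (𝟙 (K u v))

  residual? : ∀ K f u v → Dec (Residual K f u v)
  residual? K f u v = f u v ℤ.<? int (𝟙 (K u v))

  flow-mono : K ⊆ᴷ K′ → Flow K f a → Flow K′ f a
  flow-mono K⊆ F .circ = circ F
  flow-mono K⊆ F .cap u v = ℤ.≤-trans (cap F u v) (ℤ.+≤+ (𝟙-mono K⊆))

  zeroFlow : ∀ K → Flow K (λ _ _ → 0ℤ) 0
  zeroFlow K .circ = circ-loop (circ-zero {u = s} {r = 0ℤ})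
  zeroFlow K .cap u v = ℤ.+≤+ z≤n

  augment : Flow K f a → (p : Path (Residual K f) ρ s t) →
            Flow K (λ u v → f u v ℤ.+ pathFlow p u v) (suc a)
  augment {f = f} {a = a} F p .circ =
    subst (λ m → Circ s t (int m) (λ u v → f u v ℤ.+ pathFlow p u v)) (ℕ.+-comm a 1) (circ-+ (circ F) (pathFlow-circ p))
  augment {f = f} F p .cap u v with pathFlow-bound p u v
  ... | inj₁ p≤0 = ℤ.≤-trans (ℤ.+-mono-≤ (cap F u v) p≤0) (ℤ.≤-reflexive (ℤ.+-identityʳ _))
  ... | inj₂ (p≤1 , res , _) = ℤ.≤-trans (ℤ.+-monoʳ-≤ (f u v) p≤1)
    (subst (ℤ._≤ _) (ℤ.+-comm 1ℤ (f u v)) (ℤ.i<j⇒suc[i]≤j res))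

  module _ {G : Graph n} {S : VSet n} (Ss : S s ≡ true) (St : S t ≡ false) where

    private
      -- With the indicator of `S` as potential, `potential-identity` reads off the net flow across
      -- the cut, counted twice.
      p : V → ℤ
      p u = int (𝟙 (S u))

      crossing : V → V → ℕ
      crossing u v = 𝟙 (S u ∧ not (S v) ∧ adj G u v)

      cuts : ∑ᶻ₂ (λ u v → int (crossing u v + crossing v u)) ≡ int (cutSize G S + cutSize G S)
      cuts = trans (∑ᶻ₂-pos _) (cong int (trans (∑₂-+ crossing (λ u v → crossing v u))
        (sym (cong₂ _+_ (cutSize-∑₂ G S) (trans (cutSize-∑₂ G S) (∑₂-swap crossing))))))

      value : Flow K f a → ∑ᶻ₂ (λ u v → f u v ℤ.* (p u ℤ.- p v)) ≡ int (a + a)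
      value {a = a} F = trans (potential-identity (circ F) p) (cong₂ ℤ._+_ value₁ value₁)
        where
        value₁ : int a ℤ.* (p s ℤ.- p t) ≡ int a
        value₁ = trans (cong₂ (λ x y → int a ℤ.* (int (𝟙 x) ℤ.- int (𝟙 y))) Ss St) (ℤ.*-identityʳ (int a))

      negated : ∀ x → x ℤ.* (0ℤ ℤ.- 1ℤ) ≡ ℤ.- x
      negated = solveᶻ-∀

    flow≤cut : Flow K f a → K ⊆ᴳ G → a ≤ cutSize G S
    flow≤cut {K} {f} F K⊆G = m+m≤n+n⇒m≤n (ℤ.drop‿+≤+
      (subst₂ ℤ._≤_ (value F) cuts (∑ᶻ₂-mono pointwise)))
      where
      edge : ∀ u v → f u v ℤ.≤ int (𝟙 (adj G u v))
      edge u v = ℤ.≤-trans (cap F u v) (ℤ.+≤+ (𝟙-mono K⊆G))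
      pointwise : ∀ u v → f u v ℤ.* (p u ℤ.- p v) ℤ.≤ int (crossing u v + crossing v u)
      pointwise u v with S u | S v
      ... | true  | true  = ℤ.≤-reflexive (ℤ.*-zeroʳ (f u v))
      ... | false | false = ℤ.≤-reflexive (ℤ.*-zeroʳ (f u v))
      ... | true  | false rewrite ℤ.*-identityʳ (f u v) | ℕ.+-identityʳ (𝟙 (adj G u v)) = edge u v
      ... | false | true  rewrite negated (f u v) | sym (skew (circ F) u v) = edge v u

    -- Strong duality with an error term: `e` bounds the residual capacity in `G` from `S` to its
    -- complement. Slack zero certifies a minimum cut; nonzero slack on a thin pair of levels bounds
    -- the remaining augmentations.
    cut≤flow+slack : Flow K f a → (e : V → V → ℕ) →
      (∀ u v → S u ≡ true → S v ≡ false → int (𝟙 (adj G u v)) ℤ.≤ f u v ℤ.+ int (e u v)) →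
      cutSize G S ≤ a + ∑₂ e
    cut≤flow+slack {f = f} {a = a} F e slack = m+m≤n+n⇒m≤n (ℤ.drop‿+≤+
      (subst₂ ℤ._≤_ cuts total (∑ᶻ₂-mono pointwise)))
      where
      pointwise : ∀ u v → int (crossing u v + crossing v u) ℤ.≤ f u v ℤ.* (p u ℤ.- p v) ℤ.+ int (e u v + e v u)
      pointwise u v with S u in Su | S v in Sv
      ... | true  | true  rewrite ℤ.*-zeroʳ (f u v) = ℤ.+≤+ z≤n
      ... | false | false rewrite ℤ.*-zeroʳ (f u v) = ℤ.+≤+ z≤n
      ... | true  | false rewrite ℤ.*-identityʳ (f u v) | ℕ.+-identityʳ (𝟙 (adj G u v)) =
        ℤ.≤-trans (slack u v Su Sv) (ℤ.+-monoʳ-≤ (f u v) (ℤ.+≤+ (ℕ.m≤m+n _ _)))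
      ... | false | true  rewrite negated (f u v) | sym (skew (circ F) u v) =
        ℤ.≤-trans (slack v u Sv Su) (ℤ.+-monoʳ-≤ (f v u) (ℤ.+≤+ (ℕ.m≤n+m _ _)))
      regroup : ∀ a e → (a + a) + (e + e) ≡ (a + e) + (a + e)
      regroup = solve-∀
      total : ∑ᶻ₂ (λ u v → f u v ℤ.* (p u ℤ.- p v) ℤ.+ int (e u v + e v u)) ≡ int ((a + ∑₂ e) + (a + ∑₂ e))
      total = trans (∑ᶻ₂-+ _ _) (trans (cong₂ ℤ._+_ (value F) (trans (∑ᶻ₂-pos _)
        (cong int (trans (∑₂-+ e (λ u v → e v u)) (cong (∑₂ e +_) (sym (∑₂-swap e)))))))
        (cong int (regroup a (∑₂ e))))

  flow-value≤n : s ≢ t → Flow K f a → a ≤ n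
  flow-value≤n {K} {f} {a} s≢t F = ℕ.≤-trans (ℤ.drop‿+≤+ (ℤ.≤-trans (ℤ.≤-reflexive (sym out))
    (ℤ.≤-trans (∑ᶻ-mono (cap F s)) (ℤ.≤-reflexive (∑ᶻ-pos _))))) (∑-𝟙≤n (K s))
    where
    out : ∑ᶻ (f s) ≡ int a
    out rewrite div (circ F) s | ==-refl s | ==-≢ s≢t = ℤ.*-identityʳ (int a)

  -- The digraph along which f falls short of f₀: the reversed support of the flow f - f₀.
  below : (f f₀ : V → V → ℤ) → V → V → Bool
  below f f₀ u v = does (f u v ℤ.<? f₀ u v)

  Acyclic : (V → V → Bool) → Set
  Acyclic E = ∀ u v → E u v ≡ true → Reachability.reaches E u v ≡ false

  private
    -- Here `x` stands for the deviation from `f₀` on a pair and `c` for the amount a cycle pushes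
    -- there. A positive push is one unit onto a negative deviation, and the mirrored hypothesis
    -- treats negative pushes, so every push moves the deviation towards zero.
    push-toward : ∀ x c → c ℤ.≤ 0ℤ ⊎ (c ℤ.≤ 1ℤ × x ℤ.< 0ℤ) → ℤ.- c ℤ.≤ 0ℤ ⊎ (ℤ.- c ℤ.≤ 1ℤ × ℤ.- x ℤ.< 0ℤ) →
                  ∣ x ℤ.+ c ∣ ≤ ∣ x ∣ × (1ℤ ℤ.≤ c → ∣ x ℤ.+ c ∣ < ∣ x ∣)
    push-toward x (int 0) _ _ = ℕ.≤-reflexive (cong ∣_∣ (ℤ.+-identityʳ x)) , λ { (ℤ.+≤+ ()) }
    push-toward (-[1+ zero ])  (int 1) _ _ = z≤n , λ _ → s≤s z≤n
    push-toward (-[1+ suc m ]) (int 1) _ _ = ℕ.n≤1+n _ , λ _ → ℕ.≤-refl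
    push-toward (int m) (int 1) (inj₂ (_ , ℤ.+<+ ())) _
    push-toward (int m) (int 1) (inj₁ (ℤ.+≤+ ())) _
    push-toward x (int (suc (suc _))) (inj₁ (ℤ.+≤+ ())) _
    push-toward x (int (suc (suc _))) (inj₂ (ℤ.+≤+ (s≤s ()) , _)) _
    push-toward (int zero) -[1+ zero ] _ (inj₂ (_ , ℤ.+<+ ()))
    push-toward (int (suc m)) -[1+ zero ] _ _ = ℕ.n≤1+n m , λ ()
    push-toward -[1+ m ] -[1+ zero ] _ (inj₂ (_ , ℤ.+<+ ()))
    push-toward x -[1+ zero ] _ (inj₁ (ℤ.+≤+ ()))
    push-toward x -[1+ suc c ] _ (inj₁ (ℤ.+≤+ ()))
    push-toward x -[1+ suc c ] _ (inj₂ (ℤ.+≤+ (s≤s ()) , _))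

  -- One unit is pushed around a cycle of `below`. Every entry stays between its values in `f` and
  -- `f₀`, both feasible for `K`, so capacities survive; the value is unchanged, and the L1 distance
  -- to `f₀` drops, which bounds the number of rounds.
  acyclic-flow : Flow K₀ f₀ b → K₀ ⊆ᴷ K → Flow K f a → ∃ λ f′ → Flow K f′ a × Acyclic (below f′ f₀)
  acyclic-flow {K₀} {f₀} {K = K} {f = f} {a = a} F₀ K₀⊆K F = descend (suc (distance f)) f F ℕ.≤-refl
    where
    distance : (V → V → ℤ) → ℕ
    distance f = ∑₂ λ u v → ∣ f u v ℤ.- f₀ u v ∣

    module Cancel (f : V → V → ℤ) (F : Flow K f a) (x y : V) (xy : below f f₀ x y ≡ true)
                  (yx : Reachability.reaches (below f f₀) x y ≡ true) where
      open Reachability (below f f₀) x using (path)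

      cycle : V → V → ℤ
      cycle u v = arc x y u v ℤ.+ pathFlow (path yx) u v

      cycle-circ : Circ x x 1ℤ cycle
      cycle-circ = circ-trans (arc-circ x y) (pathFlow-circ (path yx))

      x≢y : x ≢ y
      x≢y refl = ℤ.<-irrefl (trans (self (circ F)) (sym (self (circ F₀)))) (does-true (_ ℤ.<? _) xy)
        where
        self : ∀ {r} {g : V → V → ℤ} → Circ s t r g → g x x ≡ 0ℤ
        self {g = g} C with g x x | skew C x x
        ... | int zero | _ = refl

      Pushable : V → V → Set
      Pushable u v = cycle u v ℤ.≤ 0ℤ ⊎ (cycle u v ℤ.≤ 1ℤ × f u v ℤ.< f₀ u v)

      pushable : ∀ u v → Pushable u v
      pushable u v with (u Fin.≟ x) ×-dec (v Fin.≟ y) | pathFlow-bound (path yx) u v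
      ... | yes (refl , refl) | inj₁ p≤0 = inj₂
        (ℤ.+-mono-≤ (ℤ.≤-reflexive (arc-self x≢y)) p≤0 , does-true (_ ℤ.<? _) xy)
      -- The path runs from `y` down to `x`, so it cannot contain the descending arc from `x` to
      -- `y`.
      ... | yes (refl , refl) | inj₂ (_ , _ , y<x) = contradiction (path-descends (path yx)) (ℕ.<⇒≱ y<x)
      ... | no ¬xy | inj₁ p≤0 = inj₁ (ℤ.+-mono-≤ (arc≤0 ¬xy) p≤0)
      ... | no ¬xy | inj₂ (p≤1 , uv , _) = inj₂ (ℤ.+-mono-≤ (arc≤0 ¬xy) p≤1 , does-true (_ ℤ.<? _) uv)

      f′ : V → V → ℤ
      f′ u v = f u v ℤ.+ cycle u v

      F′ : Flow K f′ a
      F′ .circ = subst (λ r → Circ s t r f′) (ℤ.+-identityʳ (int a)) (circ-+ (circ F) (circ-loop cycle-circ))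
      F′ .cap u v with pushable u v
      ... | inj₁ c≤0 = ℤ.≤-trans (ℤ.+-mono-≤ (cap F u v) c≤0) (ℤ.≤-reflexive (ℤ.+-identityʳ _))
      ... | inj₂ (c≤1 , lt) = ℤ.≤-trans (ℤ.+-monoʳ-≤ (f u v) c≤1)
        (ℤ.≤-trans (subst (ℤ._≤ f₀ u v) (ℤ.+-comm 1ℤ (f u v)) (ℤ.i<j⇒suc[i]≤j lt)) (cap (flow-mono K₀⊆K F₀) u v))

      closer : distance f′ < distance f
      closer = ∑₂-mono-< (λ u v → proj₁ (nearer u v)) x y (proj₂ (nearer x y) 1≤cycle)
        where
        shift : ∀ u v → Pushable u v →
                cycle u v ℤ.≤ 0ℤ ⊎ (cycle u v ℤ.≤ 1ℤ × f u v ℤ.- f₀ u v ℤ.< 0ℤ)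
        shift u v (inj₁ c≤0)        = inj₁ c≤0
        shift u v (inj₂ (c≤1 , lt)) = inj₂ (c≤1 ,
          subst (f u v ℤ.- f₀ u v ℤ.<_) (ℤ.+-inverseʳ (f₀ u v)) (ℤ.+-monoˡ-< (ℤ.- f₀ u v) lt))
        rearrange : ∀ a b c → a ℤ.- b ℤ.+ c ≡ a ℤ.+ c ℤ.- b
        rearrange = solveᶻ-∀
        -x-y : ∀ x y → ℤ.- x ℤ.- ℤ.- y ≡ ℤ.- (x ℤ.- y)
        -x-y = solveᶻ-∀
        nearer : ∀ u v → ∣ f′ u v ℤ.- f₀ u v ∣ ≤ ∣ f u v ℤ.- f₀ u v ∣ ×
                         (1ℤ ℤ.≤ cycle u v → ∣ f′ u v ℤ.- f₀ u v ∣ < ∣ f u v ℤ.- f₀ u v ∣)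
        nearer u v = subst (λ z → ∣ z ∣ ≤ _ × (1ℤ ℤ.≤ cycle u v → ∣ z ∣ < _)) (rearrange (f u v) (f₀ u v) (cycle u v))
          (push-toward _ (cycle u v) (shift u v (pushable u v))
            (subst₂ (λ c d → c ℤ.≤ 0ℤ ⊎ (c ℤ.≤ 1ℤ × d ℤ.< 0ℤ)) (skew cycle-circ u v)
              (trans (cong₂ ℤ._-_ (skew (circ F) u v) (skew (circ F₀) u v)) (-x-y (f u v) (f₀ u v)))
              (shift v u (pushable v u))))
        -- The closing arc contributes one. The path could only undo it by using the arc from `y` to
        -- `x`, which skew symmetry excludes from `below` once the arc from `x` to `y` belongs to
        -- it.
        1≤cycle : 1ℤ ℤ.≤ cycle x y
        1≤cycle with pathFlow-bound (path yx) y x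
        ... | inj₁ p≤0 = ℤ.+-mono-≤ (ℤ.≤-reflexive (sym (arc-self x≢y)))
          (subst (0ℤ ℤ.≤_) (sym (skew (pathFlow-circ (path yx)) y x)) (ℤ.neg-mono-≤ p≤0))
        ... | inj₂ (_ , yx , _) = contradiction (does-true (_ ℤ.<? _) xy)
          (ℤ.<-asym (subst₂ ℤ._<_ (sym (skew (circ F₀) y x)) (sym (skew (circ F) y x))
            (ℤ.neg-mono-< (does-true (_ ℤ.<? _) yx))))

    descend : ∀ m f → Flow K f a → distance f < m → ∃ λ f′ → Flow K f′ a × Acyclic (below f′ f₀)
    descend (suc m) f F d<m
      with Fin.any? (λ x → Fin.any? λ y → (below f f₀ x y Bool.≟ true) ×-dec (Reachability.reaches (below f f₀) x y Bool.≟ true))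
    ... | yes (x , y , xy , yx) =
      let open Cancel f F x y xy yx in descend m f′ F′ (ℕ.<-≤-trans closer (ℕ.≤-pred d<m))
    ... | no none = f , F , λ x y xy → Bool.¬-not λ yx → none (x , y , xy , yx)

-- Ranks in acyclic digraphs and the support of acyclic flows

2xy≤x²+y² : ∀ x y → 2 * (x * y) ≤ x * x + y * y
2xy≤x²+y² x y with ℕ.≤-total x y
... | inj₁ x≤y = subst (λ y → 2 * (x * y) ≤ x * x + y * y) (ℕ.m+[n∸m]≡n x≤y) (with-gap x (y ∸ x))
  where
  expand : ∀ x k → 2 * (x * (x + k)) + k * k ≡ x * x + (x + k) * (x + k)
  expand = solve-∀
  with-gap : ∀ x k → 2 * (x * (x + k)) ≤ x * x + (x + k) * (x + k)
  with-gap x k = ℕ.≤-trans (ℕ.m≤m+n _ (k * k)) (ℕ.≤-reflexive (expand x k))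
... | inj₂ y≤x = subst (λ x → 2 * (x * y) ≤ x * x + y * y) (ℕ.m+[n∸m]≡n y≤x) (with-gap y (x ∸ y))
  where
  expand : ∀ y k → 2 * ((y + k) * y) + k * k ≡ (y + k) * (y + k) + y * y
  expand = solve-∀
  with-gap : ∀ y k → 2 * ((y + k) * y) ≤ (y + k) * (y + k) + y * y
  with-gap y k = ℕ.≤-trans (ℕ.m≤m+n _ (k * k)) (ℕ.≤-reflexive (expand y k))

module StrictClosure {n : ℕ} (E : Fin n → Fin n → Bool)
  (acyclic : ∀ u v → E u v ≡ true → Reachability.reaches E u v ≡ false) where

  private
    variable
      u v w : Fin n

    module R (w : Fin n) = Reachability E w

    descendant? : ∀ u x → Dec (∃ λ v → E u v ≡ true × R.reaches x v ≡ true)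
    descendant? u x = Fin.any? λ v → (E u v Bool.≟ true) ×-dec (R.reaches x v Bool.≟ true)

    _≻_ : Fin n → Fin n → Bool
    u ≻ x = does (descendant? u x)

    ≻-reaches : u ≻ v ≡ true → R.reaches v u ≡ true
    ≻-reaches {u} {v} u≻v with does-true (descendant? u v) u≻v
    ... | w , Euw , r = R.reaches-step v Euw r

    reaches-trans : R.reaches v u ≡ true → R.reaches w v ≡ true → R.reaches w u ≡ true
    reaches-trans {v} {u} {w} u→v v→w =
      R.reaches-least v (λ x → R.reaches w x ≡ true) v→w (R.reaches-step w) u→v

    E⇒≻ : E u v ≡ true → u ≻ v ≡ true
    E⇒≻ {u} {v} Euv = true-does (descendant? u v) (v , Euv , R.reaches-self v)

    ≻-trans : u ≻ v ≡ true → v ≻ w ≡ true → u ≻ w ≡ true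
    ≻-trans {u} {v} {w} u≻v v≻w with does-true (descendant? u v) u≻v
    ... | x , Eux , x→v = true-does (descendant? u w) (x , Eux , reaches-trans x→v (≻-reaches v≻w))

    ≻-irrefl : u ≻ u ≡ false
    ≻-irrefl {u} = Bool.¬-not λ u≻u → case does-true (descendant? u u) u≻u of
      λ { (v , Euv , v→u) → contradiction (trans (sym v→u) (acyclic u v Euv)) λ () }

  -- Counting strict descendants gives a topological order with values at most `n`. Incomparable
  -- vertices may tie.
  rank : Fin n → ℕ
  rank u = ∑ λ x → 𝟙 (u ≻ x)

  rank≤n : ∀ u → rank u ≤ n
  rank≤n u = ∑-𝟙≤n (u ≻_)

  private
    rank-< : u ≻ v ≡ true → rank v < rank u
    rank-< {u} {v} u≻v = ∑-mono-< (λ x → 𝟙-mono (≻-trans u≻v)) v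
      (subst₂ (λ a b → 𝟙 a < 𝟙 b) (sym (≻-irrefl {v})) (sym u≻v) ℕ.≤-refl)

  E⇒rank-< : E u v ≡ true → rank v < rank u
  E⇒rank-< = rank-< ∘ E⇒≻

  private
    atLeast : Fin n → Fin n → Bool
    atLeast v w = does (rank v ≤? rank w)

    -- The strict descendants of v, and the out-neighbours of u ranked no lower
    -- than v, are disjoint sets of strict descendants of u.
    rank-gap : E u v ≡ true → rank v + ∑ (λ w → 𝟙 (E u w ∧ atLeast v w)) ≤ rank u
    rank-gap {u} {v} Euv = ℕ.≤-trans (ℕ.≤-reflexive (sym (∑-+ _ _))) (∑-mono pointwise)
      where
      pointwise : ∀ w → 𝟙 (v ≻ w) + 𝟙 (E u w ∧ atLeast v w) ≤ 𝟙 (u ≻ w)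
      pointwise w with v ≻ w in vw | E u w in uw | atLeast v w in le
      ... | true  | true  | true  = contradiction (does-true (_ ≤? _) le) (ℕ.<⇒≱ (rank-< vw))
      ... | true  | true  | false = ℕ.≤-reflexive (sym (cong 𝟙 (≻-trans (E⇒≻ Euv) vw)))
      ... | true  | false | _     = ℕ.≤-reflexive (sym (cong 𝟙 (≻-trans (E⇒≻ Euv) vw)))
      ... | false | true  | true  = ℕ.≤-reflexive (sym (cong 𝟙 (E⇒≻ uw)))
      ... | false | true  | false = z≤n
      ... | false | false | _     = z≤n

  degree : Fin n → ℕ
  degree u = ∑ (𝟙 ∘ E u)

  drop : Fin n → Fin n → ℕ
  drop u v = 𝟙 (E u v) * (rank u ∸ rank v)

  -- The squared degree counts pairs of out-neighbours, and in each pair one member is ranked no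
  -- lower than the other. The out-neighbours ranked no lower than a given `v` number at most
  -- `rank u ∸ rank v` by `rank-gap`; summing over `v` gives the drops, once for each order of the
  -- pair.
  degree²≤ : ∀ u → degree u * degree u ≤ 2 * ∑ (drop u)
  degree²≤ u = begin
    degree u * degree u
      ≡⟨ trans (*-∑ (degree u) _) (∑-cong λ v → trans (ℕ.*-comm (degree u) _) (*-∑ (𝟙 (E u v)) _)) ⟩
    ∑ (λ v → ∑ (λ w → 𝟙 (E u v) * 𝟙 (E u w)))
      ≤⟨ ∑-mono (λ v → ∑-mono (λ w → comparable (E u v) (E u w) (rank v ≤? rank w) (rank w ≤? rank v) (ℕ.≤-total _ _))) ⟩
    ∑ (λ v → ∑ (λ w → q v w + q w v))
      ≡⟨ trans (sym (∑₂-unfold _)) (trans (∑₂-+ q (λ v w → q w v)) (cong (∑₂ q +_) (sym (∑₂-swap q)))) ⟩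
    ∑₂ q + ∑₂ q
      ≡⟨ cong (∑₂ q +_) (ℕ.+-identityʳ (∑₂ q)) ⟨
    2 * ∑₂ q
      ≤⟨ ℕ.*-monoʳ-≤ 2 (ℕ.≤-trans (ℕ.≤-reflexive (∑₂-unfold q)) (∑-mono row)) ⟩
    2 * ∑ (drop u) ∎
    where
    open ℕ.≤-Reasoning
    q : Fin n → Fin n → ℕ
    q v w = 𝟙 (E u v) * 𝟙 (E u w ∧ atLeast v w)
    comparable : ∀ {x y} a b (d : Dec (x ≤ y)) (e : Dec (y ≤ x)) → x ≤ y ⊎ y ≤ x →
      𝟙 a * 𝟙 b ≤ 𝟙 a * 𝟙 (b ∧ does d) + 𝟙 b * 𝟙 (a ∧ does e)
    comparable false b d e _ = z≤n
    comparable true false d e _ = z≤n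
    comparable true true (yes _) e _ = s≤s z≤n
    comparable true true (no ¬d) (yes _) _ = s≤s z≤n
    comparable true true (no ¬d) (no ¬e) (inj₁ p) = contradiction p ¬d
    comparable true true (no ¬d) (no ¬e) (inj₂ p) = contradiction p ¬e
    row : ∀ v → ∑ (q v) ≤ drop u v
    row v with E u v in uv
    ... | false = ℕ.≤-reflexive (∑-zero λ _ → refl)
    ... | true  = subst₂ _≤_ (∑-cong λ w → sym (ℕ.+-identityʳ _)) (sym (ℕ.+-identityʳ _))
      (ℕ.m+n≤o⇒m≤o∸n _ (ℕ.≤-trans (ℕ.≤-reflexive (ℕ.+-comm _ (rank v))) (rank-gap uv)))

module _ {n : ℕ} (s t : Fin n) where
  open Flows s t

  module _ {K K₀ : Rel₂ n} {f f₀ : Fin n → Fin n → ℤ} {a b : ℕ}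
    (F : Flow K f a) (F₀ : Flow K₀ f₀ b) (b≤a : b ≤ a) (acyclic : Acyclic (below f f₀)) where

    open StrictClosure (below f f₀) acyclic

    private
      p : Fin n → ℤ
      p u = int (rank u)

      h : Fin n → Fin n → ℤ
      h u v = f₀ u v ℤ.- f u v

      h-circ : Circ s t (int b ℤ.- int a) h
      h-circ = circ-+ (circ F₀) (circ-neg (circ F))

      positive : ∀ {x y} → x ℤ.< y → 1ℤ ℤ.≤ y ℤ.- x
      positive {x} {y} lt = ℤ.≤-trans (ℤ.≤-reflexive (one x)) (ℤ.+-monoˡ-≤ (ℤ.- x) (ℤ.i<j⇒suc[i]≤j lt))
        where
        one : ∀ x → 1ℤ ≡ 1ℤ ℤ.+ x ℤ.- x
        one = solveᶻ-∀

      gap : ∀ {x y} → x < y → int (y ∸ x) ≡ int y ℤ.- int x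
      gap {x} {y} x<y = trans (sym (ℤ.⊖-≥ (ℕ.<⇒≤ x<y))) (sym (ℤ.[+m]-[+n]≡m⊖n y x))

      scale : ∀ {c} m → 1ℤ ℤ.≤ c → int m ℤ.≤ c ℤ.* int m
      scale {c} m 1≤c = subst (ℤ._≤ c ℤ.* int m) (ℤ.*-identityˡ (int m)) (ℤ.*-monoʳ-≤-nonNeg (int m) 1≤c)

      -- `h` is positive exactly on the arcs of `below`, along which the rank falls. On reversed
      -- arcs both factors change sign, and elsewhere `h` is zero, so no term of the potential sum
      -- is negative.
      drop≤ : ∀ u v → int (drop u v) ℤ.≤ h u v ℤ.* (p u ℤ.- p v)
      drop≤ u v with f u v ℤ.<? f₀ u v in below-uv
      ... | yes lt rewrite ℕ.+-identityʳ (rank u ∸ rank v) =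
        let v<u = E⇒rank-< {u} {v} (cong does below-uv)
        in subst (λ z → int (rank u ∸ rank v) ℤ.≤ h u v ℤ.* z) (gap v<u) (scale _ (positive lt))
      ... | no ≮ with f v u ℤ.<? f₀ v u in below-vu
      ... | yes lt =
        let u<v = E⇒rank-< {v} {u} (cong does below-vu)
        in ℤ.≤-trans (ℤ.+≤+ (z≤n {rank v ∸ rank u})) (ℤ.≤-trans (scale _ (positive lt)) (ℤ.≤-reflexive
             (trans (cong₂ ℤ._*_ (skew h-circ u v) (gap u<v)) (flip (h u v) (p u) (p v)))))
        where
        flip : ∀ x a b → ℤ.- x ℤ.* (b ℤ.- a) ≡ x ℤ.* (a ℤ.- b)
        flip = solveᶻ-∀
      ... | no ≮′ = ℤ.≤-reflexive (sym (trans (cong (ℤ._* (p u ℤ.- p v)) h≡0) (ℤ.*-zeroˡ (p u ℤ.- p v))))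
        where
        f₀≤f : f₀ u v ℤ.≤ f u v
        f₀≤f = ℤ.≮⇒≥ ≮
        f≤f₀ : f u v ℤ.≤ f₀ u v
        f≤f₀ = subst₂ ℤ._≤_ (ℤ.neg-involutive _) (ℤ.neg-involutive _)
          (ℤ.neg-mono-≤ (subst₂ ℤ._≤_ (skew (circ F₀) u v) (skew (circ F) u v) (ℤ.≮⇒≥ ≮′)))
        h≡0 : h u v ≡ 0ℤ
        h≡0 = ℤ.i≡j⇒i-j≡0 (ℤ.≤-antisym f₀≤f f≤f₀)

    -- With the rank as potential, `potential-identity` says that each of the `a ∸ b` units climbs
    -- from the rank of `s` to that of `t`, hence by at most `n`. The factor two comes from the
    -- ordered pairs.
    total-drop : ∑₂ drop ≤ 2 * ((a ∸ b) * n)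
    total-drop = ℤ.drop‿+≤+ (ℤ.≤-trans (ℤ.≤-reflexive (sym (∑ᶻ₂-pos drop)))
      (ℤ.≤-trans (∑ᶻ₂-mono drop≤) (ℤ.≤-trans (ℤ.≤-reflexive (potential-identity h-circ p))
      (ℤ.≤-trans (ℤ.+-mono-≤ value≤ value≤) (ℤ.≤-reflexive (cong int (cong ((a ∸ b) * n +_) (sym (ℕ.+-identityʳ _)))))))))
      where
      flip : ∀ a b x y → (b ℤ.- a) ℤ.* (x ℤ.- y) ≡ (a ℤ.- b) ℤ.* (y ℤ.- x)
      flip = solveᶻ-∀
      value≤ : (int b ℤ.- int a) ℤ.* (p s ℤ.- p t) ℤ.≤ int ((a ∸ b) * n)
      value≤ = begin
        (int b ℤ.- int a) ℤ.* (p s ℤ.- p t) ≡⟨ flip (int a) (int b) (p s) (p t) ⟩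
        (int a ℤ.- int b) ℤ.* (p t ℤ.- p s) ≡⟨ cong (ℤ._* (p t ℤ.- p s)) (trans (ℤ.[+m]-[+n]≡m⊖n a b) (ℤ.⊖-≥ b≤a)) ⟩
        int (a ∸ b) ℤ.* (p t ℤ.- p s)       ≤⟨ ℤ.*-monoˡ-≤-nonNeg (int (a ∸ b)) (ℤ.≤-trans (ℤ.i-j≤i (p t) (p s)) (ℤ.+≤+ (rank≤n t))) ⟩
        int (a ∸ b) ℤ.* int n               ≡⟨ ℤ.pos-* (a ∸ b) n ⟨
        int ((a ∸ b) * n)                   ∎
        where open ℤ.≤-Reasoning

    -- A Cauchy-Schwarz estimate without square roots: 2 `Z` deg ≤ `Z`² + deg², where `Z` is of the
    -- order of the square root of the remaining value. The 9 is 1 from the `Z`² terms plus 8 from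
    -- the total drop.
    support-bound : ∀ Z .{{_ : NonZero Z}} → a ≤ b + 2 * (Z * Z) →
                    2 * ∑₂ (λ u v → 𝟙 (below f f₀ u v)) ≤ 9 * (n * Z)
    support-bound Z a≤ = ℕ.*-cancelˡ-≤ Z (begin
      Z * (2 * ∑₂ (λ u v → 𝟙 (below f f₀ u v)))
        ≡⟨ cong (λ m → Z * (2 * m)) (∑₂-unfold _) ⟩
      Z * (2 * ∑ degree)
        ≡⟨ trans (trans (swap Z (∑ degree)) (cong (2 *_) (*-∑ Z degree))) (*-∑ 2 _) ⟩
      ∑ (λ u → 2 * (Z * degree u))
        ≤⟨ ∑-mono (λ u → ℕ.≤-trans (2xy≤x²+y² Z (degree u)) (ℕ.+-monoʳ-≤ (Z * Z) (degree²≤ u))) ⟩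
      ∑ (λ u → Z * Z + 2 * ∑ (drop u))
        ≡⟨ trans (∑-+ _ _) (cong₂ _+_ (∑-const n (Z * Z)) (trans (sym (*-∑ 2 _)) (cong (2 *_) (sym (∑₂-unfold drop))))) ⟩
      n * (Z * Z) + 2 * ∑₂ drop
        ≤⟨ ℕ.+-monoʳ-≤ (n * (Z * Z)) (ℕ.*-monoʳ-≤ 2 (ℕ.≤-trans total-drop (ℕ.*-monoʳ-≤ 2 (ℕ.*-monoˡ-≤ n
             (ℕ.≤-trans (ℕ.∸-monoˡ-≤ b a≤) (ℕ.≤-reflexive (ℕ.m+n∸m≡n b (2 * (Z * Z))))))))) ⟩
      n * (Z * Z) + 2 * (2 * (2 * (Z * Z) * n))
        ≡⟨ collect n Z ⟩
      Z * (9 * (n * Z)) ∎)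
      where
      open ℕ.≤-Reasoning
      swap : ∀ z d → z * (2 * d) ≡ 2 * (z * d)
      swap = solve-∀
      collect : ∀ n z → n * (z * z) + 2 * (2 * (2 * (z * z) * n)) ≡ z * (9 * (n * z))
      collect = solve-∀

-- Short augmentations

record Known (n : ℕ) : Set where
  constructor known
  field
    rel     : Rel₂ n
    rel-sym : ∀ u v → rel u v ≡ rel v u
open Known public

module _ {n : ℕ} where

  nothingKnown : Known n
  nothingKnown = known (λ _ _ → false) (λ _ _ → refl)

  insert : Fin n → Fin n → Known n → Known n
  insert u v K .rel x y = rel K x y ∨ between (u ==_) (v ==_) x y
  insert u v K .rel-sym x y = cong₂ _∨_ (rel-sym K x y)
    (trans (Bool.∨-comm ((u == x) ∧ (v == y)) ((v == x) ∧ (u == y))) (cong₂ _∨_ (Bool.∧-comm (v == x) (u == y)) (Bool.∧-comm (u == x) (v == y))))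

  ⊆-insert : ∀ u v K → rel K ⊆ᴷ rel (insert u v K)
  ⊆-insert u v K {x} {y} Kxy = cong (_∨ between (u ==_) (v ==_) x y) Kxy

  insert-self : ∀ u v K → rel (insert u v K) u v ≡ true
  insert-self u v K = trans (cong (λ b → rel K u v ∨ (b ∨ (v == u) ∧ (u == v))) (cong₂ _∧_ (==-refl u) (==-refl v)))
                            (Bool.∨-zeroʳ (rel K u v))

  insert⊆ᴳ : ∀ {G : Graph n} {u v} K → rel K ⊆ᴳ G → adj G u v ≡ true → rel (insert u v K) ⊆ᴳ G
  insert⊆ᴳ {G} {u} {v} K K⊆G uv {x} {y} xy with ∨-true {rel K x y} xy
  ... | inj₁ Kxy = K⊆G Kxy
  ... | inj₂ new with ∨-true {(u == x) ∧ (v == y)} new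
  ... | inj₁ p with ∧-true {u == x} p
  ... | ux , vy with does-true (u Fin.≟ x) ux | does-true (v Fin.≟ y) vy
  ... | refl | refl = uv
  insert⊆ᴳ {G} {u} {v} K K⊆G uv {x} {y} xy | inj₂ new | inj₂ p with ∧-true {v == x} p
  ... | vx , uy with does-true (v Fin.≟ x) vx | does-true (u Fin.≟ y) uy
  ... | refl | refl = trans (adj-sym G v u) uv

module Augmenting {n : ℕ} (s t : Fin n) (s≢t : s ≢ t) where

  open Flows s t

  private
    V : Set
    V = Fin n

  residual-mono : ∀ K K′ f → K ⊆ᴷ K′ → ∀ {u v} → Residual K f u v → Residual K′ f u v
  residual-mono K K′ f K⊆ r = ℤ.<-≤-trans r (ℤ.+≤+ (𝟙-mono K⊆))

  path-map : {P Q : V → V → Set} {ρ : V → ℕ} {u w : V} → (∀ {x y} → P x y → Q x y) → Path P ρ u w → Path Q ρ u w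
  path-map h []           = []
  path-map h (hop e lt p) = hop (h e) lt (path-map h p)

  length-map : {P Q : V → V → Set} {ρ : V → ℕ} {u w : V} (h : ∀ {x y} → P x y → Q x y) (p : Path P ρ u w) →
               length (path-map {Q = Q} h p) ≡ length p
  length-map h []           = refl
  length-map h (hop _ _ p) = cong suc (length-map h p)

  module _ {G : Graph n} where

    -- The condition ranges over all edges of the hidden graph. This is what lets the final levels
    -- bound every flow in `G`, although few of its edges are known.
    record ValidLevels (f : V → V → ℤ) (h : V → ℕ) : Set where
      constructor valid
      field
        steep : ∀ {x y} → adj G x y ≡ true → f x y ℤ.< 1ℤ → h x ≤ suc (h y)

    module _ {K : Rel₂ n} {f : V → V → ℤ} {a : ℕ} {h : V → ℕ} {d Z : ℕ}
      (F : Flow K f a) (K⊆G : K ⊆ᴳ G) (valid-h : ValidLevels f h)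
      (hs : h s ≡ d) (ht : h t ≡ 0) (large : n + n < d * Z) where

      private
        level : ℕ → V → ℕ
        level i u = 𝟙 (does (h u ℕ.≟ i))

        size : ℕ → ℕ
        size i = ∑ (level i)

        sizes≤n : (i : Fin d → ℕ) → (∀ x → ∑ (λ j → 𝟙 (does (x ℕ.≟ i j))) ≤ 1) → ∑ (size ∘ i) ≤ n
        sizes≤n i once = ℕ.≤-trans (ℕ.≤-reflexive (∑-swap _))
          (ℕ.≤-trans (∑-bound (once ∘ h)) (ℕ.≤-reflexive (ℕ.*-identityʳ n)))

        Thin : Fin d → Set
        Thin i = size (suc (toℕ i)) + size (toℕ i) < Z

        -- Averaging: every vertex lies on at most one level, hence in at most two of the `d`
        -- consecutive pairs, whose sizes therefore sum to at most 2n < d `Z`.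
        thin : ∃ Thin
        thin with Fin.any? (λ i → size (suc (toℕ i)) + size (toℕ i) <? Z)
        ... | yes found = found
        ... | no none = contradiction large (ℕ.≤⇒≯ (begin
          d * Z                                            ≡⟨ ∑-const d Z ⟨
          ∑ {d} (λ _ → Z)                                  ≤⟨ ∑-mono (λ i → ℕ.≮⇒≥ λ lt → none (i , lt)) ⟩
          ∑ (λ i → size (suc (toℕ i)) + size (toℕ i))      ≡⟨ ∑-+ _ _ ⟩
          ∑ {d} (size ∘ suc ∘ toℕ) + ∑ {d} (size ∘ toℕ)    ≤⟨ ℕ.+-mono-≤ (sizes≤n _ (∑-≟-suc-toℕ≤1 d)) (sizes≤n _ (∑-≟-toℕ≤1 d)) ⟩
          n + n                                            ∎))
          where open ℕ.≤-Reasoning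

        -1≤f : ∀ u v → -[1+ 0 ] ℤ.≤ f u v
        -1≤f u v = subst (-[1+ 0 ] ℤ.≤_) (sym (skew (circ F) v u))
          (ℤ.neg-mono-≤ (ℤ.≤-trans (cap F v u) (ℤ.+≤+ (𝟙≤1 (K v u)))))

        0≤f : ∀ u v → K v u ≡ false → 0ℤ ℤ.≤ f u v
        0≤f u v Kvu = subst (0ℤ ℤ.≤_) (sym (skew (circ F) v u))
          (ℤ.neg-mono-≤ (subst (λ b → f v u ℤ.≤ int (𝟙 b)) Kvu (cap F v u)))

      -- Only arcs between two consecutive levels are residual across a level cut.
      few-augmentations : {K′ : Rel₂ n} {f′ : V → V → ℤ} {a′ : ℕ} → Flow K′ f′ a′ → K′ ⊆ᴳ G → a′ ≤ a + 2 * (Z * Z)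
      few-augmentations {K′} F′ K′⊆G with thin
      ... | i , small = ℕ.≤-trans (flow≤cut {G = G} {S} Ss St {K = K′} F′ K′⊆G) (ℕ.≤-trans (cut≤flow+slack {G = G} {S} Ss St F e slack)
        (ℕ.+-monoʳ-≤ a (ℕ.≤-trans (ℕ.≤-reflexive total) (ℕ.*-monoʳ-≤ 2 (ℕ.*-mono-≤ {size (suc j)} {Z} {size j} {Z}
          (ℕ.≤-trans (ℕ.m≤m+n (size (suc j)) (size j)) (ℕ.<⇒≤ small)) (ℕ.≤-trans (ℕ.m≤n+m (size j) (size (suc j))) (ℕ.<⇒≤ small)))))))
        where
        j : ℕ
        j = toℕ i
        S : VSet n
        S u = does (suc j ≤? h u)
        Ss : S s ≡ true
        Ss = true-does (_ ≤? _) (subst (j <_) (sym hs) (Fin.toℕ<n i))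
        St : S t ≡ false
        St = subst (λ x → does (suc j ≤? x) ≡ false) (sym ht) refl
        -- Two is the largest residual capacity of an edge: its flow can change from -1 to 1.
        e : V → V → ℕ
        e u v = 2 * level (suc j) u * level j v
        total : ∑₂ e ≡ 2 * (size (suc j) * size j)
        total = trans (∑₂-* _ _) (trans (cong (_* size j) (sym (*-∑ 2 _))) (ℕ.*-assoc 2 (size (suc j)) (size j)))
        slack : ∀ u v → S u ≡ true → S v ≡ false → int (𝟙 (adj G u v)) ℤ.≤ f u v ℤ.+ int (e u v)
        slack u v Su Sv with adj G u v in uv
        ... | false = ℤ.+-mono-≤ (0≤f u v (Bool.¬-not λ Kvu →
                contradiction (trans (sym uv) (trans (adj-sym G u v) (K⊆G Kvu))) λ ())) (ℤ.+≤+ (z≤n {e u v}))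
        ... | true with f u v ℤ.<? 1ℤ
        ... | no saturated = ℤ.+-mono-≤ (ℤ.≮⇒≥ saturated) (ℤ.+≤+ (z≤n {e u v}))
        ... | yes res = subst (λ m → 1ℤ ℤ.≤ f u v ℤ.+ int m) (sym e≡2) (ℤ.+-monoˡ-≤ (int 2) (-1≤f u v))
          where
          low : h v ≤ j
          low = ℕ.≤-pred (ℕ.≰⇒> λ j<hv → contradiction (trans (sym Sv) (true-does (_ ≤? _) j<hv)) λ ())
          high : suc j ≤ h u
          high = does-true (_ ≤? _) Su
          bridge : h u ≤ suc (h v)
          bridge = ValidLevels.steep valid-h uv res
          e≡2 : e u v ≡ 2
          e≡2 = cong₂ (λ x y → 2 * 𝟙 x * 𝟙 y)
            (true-does (_ ℕ.≟ _) (ℕ.≤-antisym (ℕ.≤-trans bridge (s≤s low)) high))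
            (true-does (_ ℕ.≟ _) (ℕ.≤-antisym low (ℕ.≤-pred (ℕ.≤-trans high bridge))))

  record KnownFlow : Set where
    constructor knownFlow
    field
      {edges} : Known n
      {flow}  : V → V → ℤ
      value   : ℕ
      isFlow  : Flow (rel edges) flow value
  open KnownFlow public

  module LevelSearch (d : ℕ) where

    -- The search walks backwards from `t` towards `s`. `d ∸ levels` plays the part of a
    -- push-relabel distance label from `s`: it starts at zero everywhere, stays zero at `s`, and
    -- only grows. The phase ends when the label of `t` reaches `d`, that is, when its level is 0.
    record State : Set where
      constructor state
      field
        known-flow : KnownFlow
        levels     : V → ℕ
        {head}     : V
        pathToT    : Path (Residual (rel (edges known-flow)) (flow known-flow)) levels head t
    open State

    module _ (σ : State) where
      private
        K : Known n
        K = edges (known-flow σ)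
        f : V → V → ℤ
        f = flow (known-flow σ)
        h : V → ℕ
        h = levels σ
        u : V
        u = head σ

      candidates : VSet n
      candidates x = does (h x ℕ.≟ suc (h u)) ∧ does (f x u ℤ.<? 1ℤ)

      augmented : u ≡ s → State
      augmented refl = state (knownFlow {K} (suc (value (known-flow σ))) (augment (isFlow (known-flow σ)) (pathToT σ))) h []

      lowered : V → ℕ
      lowered y = if u == y then pred (h u) else h y

      lowered-other : ∀ {y} → u ≢ y → lowered y ≡ h y
      lowered-other u≢y = cong (λ b → if b then pred (h u) else h _) (==-≢ u≢y)

      lowered-self : lowered u ≡ pred (h u)
      lowered-self = cong (λ b → if b then pred (h u) else h u) (==-refl u)

      private
        keep : ∀ {v} → h v < h u → Path (Residual (rel K) f) h v t → Path (Residual (rel K) f) lowered v t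
        keep lt [] = []
        keep {v} lt (hop {v = w} e w<v p) = hop e
          (subst₂ _<_ (sym (lowered-other (λ { refl → ℕ.<-asym w<v lt }))) (sym (lowered-other (λ { refl → ℕ.<-irrefl refl lt }))) w<v)
          (keep (ℕ.<-trans w<v lt) p)

        length-keep : ∀ {v} (lt : h v < h u) (p : Path (Residual (rel K) f) h v t) → length (keep lt p) ≡ length p
        length-keep lt []            = refl
        length-keep lt (hop _ w<v p) = cong suc (length-keep (ℕ.<-trans w<v lt) p)

        popped : ∀ {x} → x ≡ u → Path (Residual (rel K) f) h x t → ∃ λ y → Path (Residual (rel K) f) lowered y t
        popped refl []           = t , []
        popped refl (hop _ lt p) = _ , keep lt p

        length-popped : ∀ {x} (eq : x ≡ u) (p : Path (Residual (rel K) f) h x t) → length p ≤ suc (length (proj₂ (popped eq p)))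
        length-popped refl []           = z≤n
        length-popped refl (hop _ lt p) = ℕ.≤-reflexive (cong suc (sym (length-keep lt p)))

      relabelled : State
      relabelled = state (known-flow σ) lowered (proj₂ (popped refl (pathToT σ)))

      length-relabelled : length (pathToT σ) ≤ suc (length (pathToT relabelled))
      length-relabelled = length-popped refl (pathToT σ)

      private
        residual⊆ : ∀ x {y z} → Residual (rel K) f y z → Residual (rel (insert x u K)) f y z
        residual⊆ x {y} {z} = residual-mono (rel K) (rel (insert x u K)) f (⊆-insert x u K) {y} {z}

      extended : (x : V) → candidates x ≡ true → State
      extended x c = record
        { known-flow = knownFlow {insert x u K} {f} (value (known-flow σ)) (flow-mono {K = rel K} (⊆-insert x u K) (isFlow (known-flow σ)))
        ; levels = h
        ; head = x
        ; pathToT = hop (subst (λ b → f x u ℤ.< int (𝟙 b)) (sym (insert-self x u K)) (does-true (_ ℤ.<? _) (proj₂ (∧-true c))))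
            (ℕ.≤-reflexive (sym (does-true (_ ℕ.≟ _) (proj₁ (∧-true c)))))
            (path-map (λ {y} {z} → residual⊆ x {y} {z}) (pathToT σ))
        }

      length-extended : ∀ x c → length (pathToT (extended x c)) ≡ suc (length (pathToT σ))
      length-extended x c = cong suc (length-map (λ {y} {z} → residual⊆ x {y} {z}) (pathToT σ))

      onFound : Maybe (V × V) → State
      onFound nothing = relabelled
      onFound (just (x , _)) with candidates x Bool.≟ true
      ... | yes c = extended x c
      ... | no _  = σ

      step : Prog n (State ⊎ KnownFlow)
      step with h t ℕ.≟ 0 | u Fin.≟ s
      ... | yes _ | _       = ret (inj₂ (known-flow σ))
      ... | no _  | yes u≡s = ret (inj₁ (augmented u≡s))
      -- Passing the empty relation makes every edge of `G` count as hidden, so known edges are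
      -- found again too. Since `candidates` demands flow below one, any edge found is residual.
      ... | no _  | no _    = findHidden s (λ _ _ → false) candidates (u ==_) >>= λ m → ret (inj₁ (onFound m))

    -- Extending the path gains 1. Lowering a level gains 2 and shortens the path by at most 1. An
    -- augmentation gains `suc d` and discards a path of length at most `d`.
    potential : State → ℕ
    potential σ = length (pathToT σ) + 2 * ∑ (λ x → d ∸ levels σ x) + suc d * value (known-flow σ)

    maxPotential : ℕ
    maxPotential = d + 2 * (n * d) + suc d * n

    start : State
    start = state (knownFlow {nothingKnown} 0 (zeroFlow _)) (λ _ → d) []

    findShortAugmentations : Prog n KnownFlow
    findShortAugmentations = loop step known-flow (suc maxPotential) start

    module _ {G : Graph n} where

      record Invariant (σ : State) : Set where
        constructor invariant
        field
          edges⊆G : rel (edges (known-flow σ)) ⊆ᴳ G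
          valid-h : ValidLevels {G} (flow (known-flow σ)) (levels σ)
          at-s    : levels σ s ≡ d
          below-d : ∀ x → levels σ x ≤ d
      open Invariant

      NearlyMaximum : ℕ → KnownFlow → Set
      NearlyMaximum Z φ = rel (edges φ) ⊆ᴳ G × (∀ {K f a} → Flow K f a → K ⊆ᴳ G → a ≤ value φ + 2 * (Z * Z))

      private
        bounded : ∀ σ → Invariant σ → potential σ ≤ maxPotential
        bounded σ I = ℕ.+-mono-≤ (ℕ.+-mono-≤ (ℕ.≤-trans (length-bound (pathToT σ)) (below-d I _))
          (ℕ.*-monoʳ-≤ 2 (∑-bound λ x → ℕ.m∸n≤m d (levels σ x))))
          (ℕ.*-monoʳ-≤ (suc d) (flow-value≤n s≢t (isFlow (known-flow σ))))

        Progress : State → State → Set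
        Progress σ σ′ = Invariant σ′ × potential σ < potential σ′

        -- An arc that becomes residual reverses an arc of the path. It leads to a higher level, so
        -- it cannot violate the condition on levels.
        augment-progress : ∀ σ (u≡s : head σ ≡ s) → Invariant σ → Progress σ (augmented σ u≡s)
        augment-progress σ refl I = invariant (edges⊆G I) (valid steep′) (at-s I) (below-d I) , increase
          where
          p = pathToT σ
          f = flow (known-flow σ)
          increase : potential σ < potential (augmented σ refl)
          increase = subst (potential σ <_) (regroup (2 * ∑ (λ x → d ∸ levels σ x)) (value (known-flow σ)) d)
            (ℕ.+-monoˡ-< (suc d * value (known-flow σ)) (ℕ.+-monoˡ-< (2 * ∑ (λ x → d ∸ levels σ x))
              (s≤s (ℕ.≤-trans (length-bound p) (below-d I _)))))
            where
            regroup : ∀ S a d → suc d + S + suc d * a ≡ S + suc d * suc a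
            regroup = solve-∀
          steep′ : ∀ {x y} → adj G x y ≡ true → f x y ℤ.+ pathFlow p x y ℤ.< 1ℤ → levels σ x ≤ suc (levels σ y)
          steep′ {x} {y} xy res with f x y ℤ.<? 1ℤ
          ... | yes res₀ = ValidLevels.steep (valid-h I) xy res₀
          ... | no sat with pathFlow-bound p y x
          ... | inj₂ (_ , _ , lt) = ℕ.≤-trans (ℕ.<⇒≤ lt) (ℕ.n≤1+n _)
          ... | inj₁ p≤0 = contradiction res (ℤ.≤⇒≯ (ℤ.+-mono-≤ (ℤ.≮⇒≥ sat)
                (subst (0ℤ ℤ.≤_) (sym (skew (pathFlow-circ p) y x)) (ℤ.neg-mono-≤ p≤0))))

        extend-progress : ∀ σ x (c : candidates σ x ≡ true) → adj G x (head σ) ≡ true → Invariant σ → Progress σ (extended σ x c)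
        extend-progress σ x c xu I = invariant
          (insert⊆ᴳ {G = G} (edges (known-flow σ)) (edges⊆G I) xu) (valid-h I) (at-s I) (below-d I) ,
          ℕ.+-monoˡ-< (suc d * value (known-flow σ)) (ℕ.+-monoˡ-< (2 * ∑ (λ x → d ∸ levels σ x))
            (ℕ.≤-reflexive (sym (length-extended σ x c))))

        head>0 : ∀ {P : V → V → Set} {h : V → ℕ} {u} → h t ≢ 0 → Path P h u t → 0 < h u
        head>0 ht≢0 []           = ℕ.n≢0⇒n>0 ht≢0
        head>0 ht≢0 (hop _ lt _) = ℕ.≤-<-trans z≤n lt

        -- Lowering the head can only hurt arcs into it that start exactly one level above, and the
        -- failed search says there are none. The head is above level 0 because the path descends
        -- from it to `t`.
        relabel-progress : ∀ σ → levels σ t ≢ 0 → head σ ≢ s →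
          ¬ HiddenBetween G (λ _ _ → false) (candidates σ) (head σ ==_) → Invariant σ → Progress σ (relabelled σ)
        relabel-progress σ ht≢0 u≢s none I = invariant (edges⊆G I) (valid steep′)
            (trans (lowered-other σ u≢s) (at-s I)) (λ x → ℕ.≤-trans (lowered≤ x) (below-d I x)) , increase
          where
          u = head σ
          h = levels σ
          f = flow (known-flow σ)
          u>0 : 0 < h u
          u>0 = head>0 ht≢0 (pathToT σ)
          lowered≤ : ∀ x → lowered σ x ≤ h x
          lowered≤ x with u Fin.≟ x
          ... | yes refl = ℕ.pred[n]≤n
          ... | no u≢x   = ℕ.≤-refl
          increase : potential σ < potential (relabelled σ)
          increase = ℕ.+-monoˡ-< (suc d * value (known-flow σ)) (begin-strict
            length (pathToT σ) + 2 * ∑ (λ x → d ∸ h x)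
              ≤⟨ ℕ.+-monoˡ-≤ _ (length-relabelled σ) ⟩
            suc l′ + 2 * ∑ (λ x → d ∸ h x)
              <⟨ ℕ.n<1+n _ ⟩
            suc (suc l′ + 2 * ∑ (λ x → d ∸ h x))
              ≡⟨ regroup l′ (∑ (λ x → d ∸ h x)) ⟩
            l′ + 2 * suc (∑ (λ x → d ∸ h x))
              ≤⟨ ℕ.+-monoʳ-≤ l′ (ℕ.*-monoʳ-≤ 2 (∑-mono-< (λ x → ℕ.∸-monoʳ-≤ d (lowered≤ x)) u
                   (ℕ.∸-monoʳ-< (subst (_< h u) (sym (lowered-self σ)) (ℕ.≤-reflexive (ℕ.suc-pred (h u) {{>-nonZero u>0}}))) (below-d I u)))) ⟩
            l′ + 2 * ∑ (λ x → d ∸ lowered σ x) ∎)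
            where
            open ℕ.≤-Reasoning
            l′ = length (pathToT (relabelled σ))
            regroup : ∀ l S → suc (suc l + 2 * S) ≡ l + 2 * suc S
            regroup = solve-∀
          steep′ : ∀ {x y} → adj G x y ≡ true → f x y ℤ.< 1ℤ → lowered σ x ≤ suc (lowered σ y)
          steep′ {x} {y} xy res with ValidLevels.steep (valid-h I) xy res | u Fin.≟ y
          ... | old | no _ = ℕ.≤-trans (lowered≤ x) old
          ... | old | yes refl = subst (lowered σ x ≤_) (sym (ℕ.suc-pred (h u) {{>-nonZero u>0}}))
            (ℕ.≤-trans (lowered≤ x) (ℕ.≤-pred (ℕ.≤∧≢⇒< old λ hx → none (x , u ,
              cong₂ _∧_ (true-does (_ ℕ.≟ _) hx) (true-does (_ ℤ.<? _) res) , ==-refl u , xy , refl))))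

        module _ {Z : ℕ} (large : n + n < d * Z) where

          runs-step : ∀ σ → Invariant σ → Runs G (searchCost n)
            (StepPost step known-flow {G} {searchCost n} {maxPotential} {Invariant} {NearlyMaximum Z} potential σ) (step σ)
          runs-step σ I with levels σ t ℕ.≟ 0 | head σ Fin.≟ s
          ... | yes ht | _ = runs-ret (edges⊆G I , few-augmentations (isFlow (known-flow σ)) (edges⊆G I) (valid-h I) (at-s I) ht large)
          ... | no _ | yes u≡s = runs-ret (augment-progress σ u≡s I)
          ... | no ht≢0 | no u≢s = runs-weaken (ℕ.≤-reflexive (ℕ.+-identityʳ _)) (λ _ p → p)
            (runs-bind {c = 0} (runs-findHidden s _ _ _ (λ _ _ → refl) (λ ()) disjoint) λ
              { nothing none → runs-ret (relabel-progress σ ht≢0 u≢s none I)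
              ; (just (x , u′)) (c , u≡u′ , xu′ , _) → runs-ret
                  (found {u′} x c (subst (λ w → adj G x w ≡ true) (sym (does-true (_ Fin.≟ _) u≡u′)) xu′)) })
            where
            disjoint : ∀ {x} → candidates σ x ≡ true → (head σ == x) ≡ false
            disjoint {x} c = ==-≢ {u = head σ} {x} λ { refl → ℕ.1+n≢n (sym (does-true (levels σ (head σ) ℕ.≟ _) (proj₁ (∧-true c)))) }
            found : ∀ {u′} x → candidates σ x ≡ true → adj G x (head σ) ≡ true → Progress σ (onFound σ (just (x , u′)))
            found x c xu with candidates σ x Bool.≟ true
            ... | yes c′ = extend-progress σ x c′ xu I
            ... | no ¬c  = contradiction c ¬c

      runs-findShortAugmentations : ∀ {Z} → n + n < d * Z →
        Runs G (suc maxPotential * searchCost n) (NearlyMaximum Z) findShortAugmentations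
      runs-findShortAugmentations large = runs-loop step known-flow potential bounded (runs-step large) (suc maxPotential) start
        (invariant (λ ()) (valid λ _ _ → ℕ.n≤1+n d) refl (λ _ → ℕ.≤-refl)) (ℕ.m≤m+n _ _)

-- Forest peeling

_∪⁅_⁆ : {n : ℕ} → VSet n → Fin n → VSet n
(W ∪⁅ v ⁆) x = W x ∨ (v == x)

module _ {n : ℕ} {W : VSet n} {v : Fin n} where

  ∪⁅⁆-cases : ∀ {x} → (W ∪⁅ v ⁆) x ≡ true → W x ≡ true ⊎ v ≡ x
  ∪⁅⁆-cases {x} p with ∨-true {W x} p
  ... | inj₁ Wx = inj₁ Wx
  ... | inj₂ vx = inj₂ (does-true (v Fin.≟ x) vx)

  ⊆-∪⁅⁆ : ∀ {x} → W x ≡ true → (W ∪⁅ v ⁆) x ≡ true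
  ⊆-∪⁅⁆ {x} Wx = cong (_∨ (v == x)) Wx

  ∪⁅⁆-self : (W ∪⁅ v ⁆) v ≡ true
  ∪⁅⁆-self = trans (cong (W v ∨_) (==-refl v)) (Bool.∨-zeroʳ (W v))

  ∪⁅⁆-grows : W v ≡ false → ∑ (𝟙 ∘ W) < ∑ (𝟙 ∘ (W ∪⁅ v ⁆))
  ∪⁅⁆-grows Wv = ∑-mono-< (λ x → 𝟙-mono (⊆-∪⁅⁆ {x})) v
    (subst₂ (λ a b → 𝟙 a < 𝟙 b) (sym Wv) (sym ∪⁅⁆-self) ℕ.≤-refl)

hidden-mono : {n : ℕ} {G : Graph n} {K K′ : Rel₂ n} → K ⊆ᴷ K′ → ∀ {a b} → Hidden G K′ a b → Hidden G K a b
hidden-mono K⊆K′ (e , K′ab) = e , Bool.¬-not λ Kab → contradiction (trans (sym (K⊆K′ Kab)) K′ab) λ ()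

crossings : {n : ℕ} → Rel₂ n → VSet n → ℕ
crossings K X = ∑₂ λ u v → 𝟙 (X u ∧ not (X v) ∧ K u v)

module ForestPeeling {n : ℕ} (default : Fin n) where

  private
    V : Set
    V = Fin n

  -- No hidden edge leaves `earlier`; the current tree, rooted at `root`, spans the
  -- visited vertices outside `earlier`.
  record State : Set where
    constructor state
    field
      edges   : Known n
      visited : VSet n
      earlier : VSet n
      root    : V
  open State

  fresh? : (σ : State) → Dec (∃ λ v → visited σ v ≡ false)
  fresh? σ = Fin.any? λ v → visited σ v Bool.≟ false

  newTree : (σ : State) → Dec (∃ λ v → visited σ v ≡ false) → State ⊎ Known n
  newTree σ (yes (v , _)) = inj₁ (state (edges σ) (visited σ ∪⁅ v ⁆) (visited σ) v)
  newTree σ (no _)        = inj₂ (edges σ)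

  advance : State → Maybe (V × V) → State ⊎ Known n
  advance σ (just (u , v)) = inj₁ (record σ { edges = insert u v (edges σ) ; visited = visited σ ∪⁅ v ⁆ })
  advance σ nothing        = newTree σ (fresh? σ)

  step : State → Prog n (State ⊎ Known n)
  step σ = findHidden default (rel (edges σ)) (visited σ) (not ∘ visited σ) >>= λ m → ret (advance σ m)

  peel : Known n → Prog n (Known n)
  peel K = loop step edges (suc n) (state K (λ _ → false) (λ _ → false) default)

  peels : ℕ → Known n → Prog n (Known n)
  peels zero    K = ret K
  peels (suc k) K = peel K >>= peels k

  module _ {G : Graph n} where

    hidden-sym : (K : Known n) → ∀ {a b} → Hidden G (rel K) a b → Hidden G (rel K) b a
    hidden-sym K {a} {b} (e , k) = trans (adj-sym G b a) e , trans (rel-sym K b a) k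

    module _ (K₀ : Known n) (K₀⊆G : rel K₀ ⊆ᴳ G) where

      NewCrossing : Rel₂ n → VSet n → Set
      NewCrossing K X = ∃₂ λ u v → X u ≡ true × X v ≡ false × K u v ≡ true × rel K₀ u v ≡ false

      crossing-mono : ∀ {K K′ : Rel₂ n} → K ⊆ᴷ K′ → ∀ {X} → NewCrossing K X → NewCrossing K′ X
      crossing-mono K⊆K′ (u , v , Xu , Xv , Kuv , K₀uv) = u , v , Xu , Xv , K⊆K′ Kuv , K₀uv

      -- The spanning property of a forest in terms of cuts: a set crossed by a surviving hidden
      -- edge is crossed by a newly learned one.
      Separated : Known n → VSet n → Set
      Separated K X = NewCrossing (rel K) X ⊎ (∀ a b → Hidden G (rel K) a b → X a ≡ X b)

      Peeled : Known n → Set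
      Peeled K = rel K ⊆ᴳ G × rel K₀ ⊆ᴷ rel K × (∀ X → Separated K X)

      -- Connectivity is expressed by cuts: a tree is connected if a set crossed by none of its
      -- edges contains all or none of its vertices. This avoids paths and components, and `peels`
      -- only needs the crossed sets.
      record Invariant (σ : State) : Set where
        field
          edges⊆G  : rel (edges σ) ⊆ᴳ G
          edges⊇K₀ : rel K₀ ⊆ᴷ rel (edges σ)
          nested   : ∀ {a} → earlier σ a ≡ true → visited σ a ≡ true
          sealed   : ∀ {a b} → earlier σ a ≡ true → earlier σ b ≡ false → ¬ Hidden G (rel (edges σ)) a b
          tree     : ∀ X → NewCrossing (rel (edges σ)) X ⊎
                     (∀ a → visited σ a ≡ true → earlier σ a ≡ false → X a ≡ X (root σ))
          forest   : ∀ X → NewCrossing (rel (edges σ)) X ⊎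
                     (∀ a b → earlier σ a ≡ true → earlier σ b ≡ true → Hidden G (rel (edges σ)) a b → X a ≡ X b)
      open Invariant

      potential : State → ℕ
      potential σ = ∑ (𝟙 ∘ visited σ)

      private
        -- The endpoints lie both in finished trees, both in the current one, or one in each; the
        -- last case is ruled out by `sealed`.
        visited-separated : ∀ {σ} → Invariant σ → ∀ X → NewCrossing (rel (edges σ)) X ⊎
          (∀ a b → visited σ a ≡ true → visited σ b ≡ true → Hidden G (rel (edges σ)) a b → X a ≡ X b)
        visited-separated {σ} I X with tree I X | forest I X
        ... | inj₁ c | _ = inj₁ c
        ... | inj₂ _ | inj₁ c = inj₁ c
        ... | inj₂ inTree | inj₂ inForest = inj₂ both
          where
          both : ∀ a b → visited σ a ≡ true → visited σ b ≡ true → Hidden G (rel (edges σ)) a b → X a ≡ X b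
          both a b Wa Wb hid with earlier σ a in Ea | earlier σ b in Eb
          ... | true  | true  = inForest a b Ea Eb hid
          ... | false | false = trans (inTree a Wa Ea) (sym (inTree b Wb Eb))
          ... | true  | false = contradiction hid (sealed I Ea Eb)
          ... | false | true  = contradiction (hidden-sym (edges σ) hid) (sealed I Eb Ea)

        StepResult : State → State ⊎ Known n → Set
        StepResult = StepPost step edges {G} {searchCost n} {n} {Invariant} {Peeled} potential

        grow-tree : ∀ σ u v → Invariant σ → visited σ u ≡ true → visited σ v ≡ false → Hidden G (rel (edges σ)) u v →
          StepResult σ (advance σ (just (u , v)))
        grow-tree σ u v I Wu Wv uv = record
          { edges⊆G  = insert⊆ᴳ {G = G} K (edges⊆G I) (proj₁ uv)
          ; edges⊇K₀ = ⊆-insert u v K ∘ edges⊇K₀ I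
          ; nested   = λ {a} → ⊆-∪⁅⁆ {W = visited σ} {v} {a} ∘ nested I
          ; sealed   = λ Ea Eb → sealed I Ea Eb ∘ weaken
          ; tree     = tree′
          ; forest   = λ X → case forest I X of λ
              { (inj₁ c) → inj₁ (new {X} c) ; (inj₂ h) → inj₂ λ a b Ea Eb → h a b Ea Eb ∘ weaken }
          } , ∪⁅⁆-grows {W = visited σ} Wv
          where
          K : Known n
          K = edges σ
          weaken : ∀ {a b} → Hidden G (rel (insert u v K)) a b → Hidden G (rel K) a b
          weaken = hidden-mono {G = G} {rel K} {rel (insert u v K)} (⊆-insert u v K)
          new : ∀ {X} → NewCrossing (rel K) X → NewCrossing (rel (insert u v K)) X
          new {X} = crossing-mono {rel K} {rel (insert u v K)} (⊆-insert u v K) {X}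
          K₀uv : rel K₀ u v ≡ false
          K₀uv = Bool.¬-not λ p → contradiction (trans (sym (edges⊇K₀ I p)) (proj₂ uv)) λ ()
          Eu : earlier σ u ≡ false
          Eu = Bool.¬-not λ Eu → sealed I Eu
            (Bool.¬-not λ Ev → contradiction (trans (sym (nested I Ev)) Wv) λ ()) uv
          tree′ : ∀ X → NewCrossing (rel (insert u v K)) X ⊎
                  (∀ a → (visited σ ∪⁅ v ⁆) a ≡ true → earlier σ a ≡ false → X a ≡ X (root σ))
          tree′ X with tree I X
          ... | inj₁ c = inj₁ (new {X} c)
          -- Either `X` separates `u` from `v` and the new edge itself crosses `X`, or `v` inherits
          -- the side of the root through `u`.
          ... | inj₂ constant with X u in Xu | X v in Xv
          ... | true  | false = inj₁ (u , v , Xu , Xv , insert-self u v K , K₀uv)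
          ... | false | true  = inj₁ (v , u , Xv , Xu ,
                  trans (rel-sym (insert u v K) v u) (insert-self u v K) , trans (rel-sym K₀ v u) K₀uv)
          ... | true  | true  = inj₂ λ a Wa Ea → case ∪⁅⁆-cases {W = visited σ} {v} {a} Wa of λ
                  { (inj₁ Wa) → constant a Wa Ea ; (inj₂ refl) → trans Xv (trans (sym Xu) (constant u Wu Eu)) }
          ... | false | false = inj₂ λ a Wa Ea → case ∪⁅⁆-cases {W = visited σ} {v} {a} Wa of λ
                  { (inj₁ Wa) → constant a Wa Ea ; (inj₂ refl) → trans Xv (trans (sym Xu) (constant u Wu Eu)) }

        new-tree : ∀ σ → Invariant σ → ¬ HiddenBetween G (rel (edges σ)) (visited σ) (not ∘ visited σ) →
          (d : Dec (∃ λ v → visited σ v ≡ false)) → StepResult σ (newTree σ d)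
        new-tree σ I none (yes (v , Wv)) = record
          { edges⊆G  = edges⊆G I
          ; edges⊇K₀ = edges⊇K₀ I
          ; nested   = λ {a} → ⊆-∪⁅⁆ {W = visited σ} {v} {a}
          ; sealed   = λ {a} {b} Wa Wb hid → none (a , b , Wa , cong not Wb , hid)
          ; tree     = λ X → inj₂ λ a Wa Wa′ → case ∪⁅⁆-cases {W = visited σ} {v} {a} Wa of λ
              { (inj₁ Wa″) → contradiction (trans (sym Wa″) Wa′) λ () ; (inj₂ refl) → refl }
          ; forest   = visited-separated I
          } , ∪⁅⁆-grows {W = visited σ} Wv
        new-tree σ I none (no full) = edges⊆G I , edges⊇K₀ I , λ X → case visited-separated I X of λ
          { (inj₁ c) → inj₁ c ; (inj₂ h) → inj₂ λ a b → h a b (everywhere a) (everywhere b) }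
          where
          everywhere : ∀ a → visited σ a ≡ true
          everywhere a = Bool.¬-not λ Wa → full (a , Wa)

        runs-step : ∀ σ → Invariant σ → Runs G (searchCost n) (StepResult σ) (step σ)
        runs-step σ I = runs-weaken (ℕ.≤-reflexive (ℕ.+-identityʳ _)) (λ _ p → p)
          (runs-bind {c = 0} (runs-findHidden default _ _ _ (rel-sym (edges σ)) (edges⊆G I) (cong not)) λ
            { nothing none → runs-ret (new-tree σ I none (fresh? σ))
            ; (just (u , v)) (Wu , Wv , hid) → runs-ret (grow-tree σ u v I Wu (Bool.not-injective Wv) hid) })

      runs-peel : Runs G (suc n * searchCost n) Peeled (peel K₀)
      runs-peel = runs-loop step edges potential (λ σ _ → ∑-𝟙≤n (visited σ)) runs-step (suc n) _
        (record { edges⊆G = K₀⊆G ; edges⊇K₀ = id ; nested = λ () ; sealed = λ () ; tree = λ X → inj₂ λ _ ()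
                ; forest = λ X → inj₂ λ _ _ () }) (ℕ.m≤m+n _ _)

    HighlyCrossed : ℕ → Known n → Known n → Set
    HighlyCrossed k K₀ K = rel K ⊆ᴳ G × rel K₀ ⊆ᴷ rel K ×
      (∀ X {a b} → Hidden G (rel K) a b → X a ≢ X b → crossings (rel K₀) X + k ≤ crossings (rel K) X)

    -- An edge still hidden at the end was hidden after every single peel, so each of the `k` peels
    -- contributed its own crossing edge.
    runs-peels : ∀ k K₀ → rel K₀ ⊆ᴳ G → Runs G (k * (suc n * searchCost n)) (HighlyCrossed k K₀) (peels k K₀)
    runs-peels zero    K₀ K₀⊆G = runs-ret (K₀⊆G , id , λ X _ _ → ℕ.≤-reflexive (ℕ.+-identityʳ _))
    runs-peels (suc k) K₀ K₀⊆G = runs-bind (runs-peel K₀ K₀⊆G) λ K₁ → λ { (K₁⊆G , K₀⊆K₁ , separated) →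
      runs-weaken ℕ.≤-refl (λ K → λ { (K⊆G , K₁⊆K , crossed) → K⊆G , K₁⊆K ∘ K₀⊆K₁ , λ X {a} {b} hid Xa≢Xb →
        ℕ.≤-trans (ℕ.≤-reflexive (ℕ.+-suc _ k)) (ℕ.≤-trans (ℕ.+-monoˡ-≤ k
          (one-more {K₁} X K₀⊆K₁ (case separated X of λ
            { (inj₁ c) → c
            ; (inj₂ h) → contradiction (h a b (hidden-mono {G = G} {rel K₁} {rel K} K₁⊆K hid)) Xa≢Xb })))
          (crossed X hid Xa≢Xb)) }) (runs-peels k K₁ K₁⊆G) }
      where
      one-more : ∀ {K₁} X → rel K₀ ⊆ᴷ rel K₁ → NewCrossing K₀ K₀⊆G (rel K₁) X → crossings (rel K₀) X < crossings (rel K₁) X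
      one-more {K₁} X K₀⊆K₁ (u , v , Xu , Xv , K₁uv , K₀uv) = ∑₂-mono-<
        (λ u v → 𝟙-mono λ p → let Xu , q = ∧-true {X u} p ; Xv , r = ∧-true {not (X v)} q
                              in cong₂ _∧_ Xu (cong₂ _∧_ Xv (K₀⊆K₁ r))) u v
        (subst₂ _<_ (cong 𝟙 (sym (trans (cong₂ (λ x y → x ∧ not y ∧ rel K₀ u v) Xu Xv) K₀uv)))
                    (cong 𝟙 (sym (trans (cong₂ (λ x y → x ∧ not y ∧ rel K₁ u v) Xu Xv) K₁uv))) ℕ.≤-refl)

-- Exhausting the remaining augmentations

module Finishing {n : ℕ} (s t : Fin n) (s≢t : s ≢ t) where

  open Flows s t
  open Augmenting s t s≢t using (KnownFlow; residual-mono)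
  open KnownFlow

  private
    V : Set
    V = Fin n

  module _ (base : KnownFlow) (K₂ : Known n) where

    private
      K₁ : Known n
      K₁ = edges base
      f₀ : V → V → ℤ
      f₀ = flow base
      b : ℕ
      b = value base

    record State : Set where
      constructor state
      field
        K     : Known n
        base⊆ : rel K₁ ⊆ᴷ rel K
        f     : V → V → ℤ
        a     : ℕ
        isF   : Flow (rel K) f a
        -- number of edges learned since the last augmentation
        stage : ℕ
    open State

    sink-side : State → VSet n
    sink-side σ = Reachability.reaches (λ u v → does (residual? (rel (K σ)) (f σ) u v)) t

    -- Cycles are removed relative to `f₀`, since it is the support of the difference that has to
    -- stay small.
    augmentedFlow : ∀ σ → sink-side σ s ≡ true → ∃ λ f′ → Flow (rel (K σ)) f′ (suc (a σ)) × Acyclic (below f′ f₀)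
    augmentedFlow σ r = acyclic-flow (isFlow base) (base⊆ σ) (augment (isF σ)
      (path-map (does-true (residual? (rel (K σ)) (f σ) _ _)) (Reachability.path _ t r)))
      where open Augmenting s t s≢t using (path-map)

    augmented : ∀ σ → sink-side σ s ≡ true → State
    augmented σ r = state (K σ) (base⊆ σ) (proj₁ (augmentedFlow σ r)) (suc (a σ)) (proj₁ (proj₂ (augmentedFlow σ r))) 0

    learned : State → V → V → State
    learned σ u v = state (insert u v (K σ)) (⊆-insert u v (K σ) ∘ base⊆ σ) (f σ) (a σ)
      (flow-mono {K = rel (K σ)} (⊆-insert u v (K σ)) (isF σ)) (suc (stage σ))

    source-side : State → VSet n
    source-side σ u = not (sink-side σ u)

    advance : State → Maybe (V × V) → State ⊎ VSet n
    advance σ (just (u , v)) = inj₁ (learned σ u v)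
    advance σ nothing        = inj₂ (source-side σ)

    step : State → Prog n (State ⊎ VSet n)
    step σ with sink-side σ s Bool.≟ true
    ... | yes r = ret (inj₁ (augmented σ r))
    ... | no _  = findHidden s (rel (K σ)) (source-side σ) (sink-side σ) >>= λ m → ret (advance σ m)

    module _ (base⊆K₂ : rel K₁ ⊆ᴷ rel K₂) where

      start : State
      start = state K₂ base⊆K₂ f₀ b (flow-mono {K = rel K₁} base⊆K₂ (isFlow base)) 0

      finish : ℕ → Prog n (VSet n)
      finish fuel = loop step source-side fuel start

      module _ {G : Graph n} {k Z q : ℕ} .{{_ : NonZero Z}}
        (K₂⊆G : rel K₂ ⊆ᴳ G)
        (nearMax : ∀ {K f a} → Flow K f a → K ⊆ᴳ G → a ≤ b + 2 * (Z * Z))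
        (crossed : ∀ X {u v} → Hidden G (rel K₂) u v → X u ≢ X v → crossings (rel K₁) X + k ≤ crossings (rel K₂) X)
        (stages : 9 * (n * Z) < suc q * k) where

        private
          moved : (V → V → ℤ) → V → V → Bool
          moved f u v = below f f₀ u v ∨ below f f₀ v u

          -- The account to which learned edges are charged. `f` is fixed between augmentations, so
          -- the weight grows only through `X`. A pair is paid for when its first vertex joins `X`,
          -- hence at most once in each orientation.
          weight : (V → V → ℤ) → VSet n → ℕ
          weight f X = ∑₂ λ u v → 𝟙 (X u ∧ moved f u v)

          weight≤ : ∀ f X → weight f X ≤ 2 * ∑₂ (λ u v → 𝟙 (below f f₀ u v))
          weight≤ f X = ℕ.≤-trans (∑₂-mono λ u v → pointwise (X u) (below f f₀ u v) (below f f₀ v u))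
            (ℕ.≤-reflexive (trans (∑₂-+ D (λ u v → D v u))
              (trans (cong (∑₂ D +_) (sym (∑₂-swap D))) (cong (∑₂ D +_) (sym (ℕ.+-identityʳ _))))))
            where
            D : V → V → ℕ
            D u v = 𝟙 (below f f₀ u v)
            pointwise : ∀ x a b → 𝟙 (x ∧ (a ∨ b)) ≤ 𝟙 a + 𝟙 b
            pointwise false a b = z≤n
            pointwise true true b = s≤s z≤n
            pointwise true false b = ℕ.≤-refl

        record Invariant (σ : State) : Set where
          field
            K⊆G     : rel (K σ) ⊆ᴳ G
            K₂⊆K    : rel K₂ ⊆ᴷ rel (K σ)
            b≤a     : b ≤ a σ
            acyclic : Acyclic (below (f σ) f₀)
            charged : stage σ * k ≤ weight (f σ) (sink-side σ)
        open Invariant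

        -- The lexicographic order on value and stage, coded with base `suc q` because a stage never
        -- exceeds `q`.
        potential : State → ℕ
        potential σ = a σ * suc q + stage σ

        private
          stage≤q : ∀ σ → Invariant σ → stage σ ≤ q
          stage≤q σ I = ℕ.≤-pred (ℕ.*-cancelʳ-< k (stage σ) (suc q) (ℕ.≤-<-trans (charged I)
            (ℕ.≤-<-trans (weight≤ (f σ) (sink-side σ)) (ℕ.≤-<-trans
              (support-bound s t (isF σ) (isFlow base) (b≤a I) (acyclic I) Z (nearMax (isF σ) (K⊆G I))) stages))))

          Progress : State → State → Set
          Progress σ σ′ = Invariant σ′ × potential σ < potential σ′

          augment-progress : ∀ σ r → Invariant σ → Progress σ (augmented σ r)
          augment-progress σ r I = record
            { K⊆G = K⊆G I ; K₂⊆K = K₂⊆K I ; b≤a = ℕ.m≤n⇒m≤1+n (b≤a I)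
            ; acyclic = proj₂ (proj₂ (augmentedFlow σ r)) ; charged = z≤n } ,
            subst (potential σ <_) (trans (ℕ.+-comm (a σ * suc q) (suc q)) (sym (ℕ.+-identityʳ _)))
              (ℕ.+-monoʳ-< (a σ * suc q) (s≤s (stage≤q σ I)))

          -- Known edges leaving the source side are saturated, or their tail would reach `t`, and
          -- hidden ones do not exist. Duality then holds with slack zero, and the flow bounds every
          -- other cut from below.
          minimum : ∀ σ → Invariant σ → sink-side σ s ≢ true →
            ¬ HiddenBetween G (rel (K σ)) (source-side σ) (sink-side σ) → IsMinSTCut G s t (source-side σ)
          minimum σ I s∉R none = (Ss , St) , λ S′ → λ { (S′s , S′t) → ℕ.≤-trans
            (subst (cutSize G (source-side σ) ≤_) no-slack
              (cut≤flow+slack {G = G} {source-side σ} Ss St (isF σ) (λ _ _ → 0) tight))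
            (flow≤cut {G = G} {S′} S′s S′t {K = rel (K σ)} (isF σ) (K⊆G I)) }
            where
            open Reachability (λ u v → does (residual? (rel (K σ)) (f σ) u v)) t
            Ss : source-side σ s ≡ true
            Ss = cong not (Bool.¬-not s∉R)
            St : source-side σ t ≡ false
            St = cong not reaches-self
            no-slack : a σ + ∑₂ {n} (λ _ _ → 0) ≡ a σ
            no-slack = trans (cong (a σ +_) (trans (∑₂-unfold _) (∑-zero λ _ → ∑-zero λ _ → refl))) (ℕ.+-identityʳ _)
            tight : ∀ u v → source-side σ u ≡ true → source-side σ v ≡ false →
                    int (𝟙 (adj G u v)) ℤ.≤ f σ u v ℤ.+ int 0
            tight u v Su Sv = ℤ.≤-trans (ℤ.+≤+ (𝟙-mono λ uv → Bool.¬-not λ Kuv → none (u , v , Su , Rv , uv , Kuv)))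
              (ℤ.≤-trans (ℤ.≮⇒≥ λ res → contradiction
                (trans (sym (cong not (reaches-step (true-does (_ ℤ.<? _) res) Rv))) Su) λ ())
                (ℤ.≤-reflexive (sym (ℤ.+-identityʳ (f σ u v)))))
              where
              Rv : sink-side σ v ≡ true
              Rv = Bool.not-injective Sv

          module Learn (σ : State) (I : Invariant σ) (u v : V) (Su : source-side σ u ≡ true) (Rv : sink-side σ v ≡ true)
                       (hid : Hidden G (rel (K σ)) u v) where

            R R′ Y : VSet n
            R = sink-side σ
            R′ = sink-side (learned σ u v)
            Y x = R′ x ∧ not (R x)

            module Old = Reachability (λ x y → does (residual? (rel (K σ)) (f σ) x y)) t
            module New = Reachability (λ x y → does (residual? (rel (insert u v (K σ))) (f σ) x y)) t

            R⊆R′ : ∀ {x} → R x ≡ true → R′ x ≡ true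
            R⊆R′ = Old.reaches-least (λ x → R′ x ≡ true) New.reaches-self λ {x} {y} res →
              New.reaches-step (true-does (_ ℤ.<? _)
                (residual-mono (rel (K σ)) (rel (insert u v (K σ))) (f σ) (⊆-insert u v (K σ)) {x} {y}
                  (does-true (residual? (rel (K σ)) (f σ) x y) res)))

            -- The hidden edge had capacity zero, so `f` is at most 0 on it and inserting it makes
            -- it residual.
            u∈R′ : R′ u ≡ true
            u∈R′ = New.reaches-step (true-does (_ ℤ.<? _) (subst (λ c → f σ u v ℤ.< int (𝟙 c))
              (sym (insert-self u v (K σ))) (ℤ.≤-<-trans (subst (λ c → f σ u v ℤ.≤ int (𝟙 c)) (proj₂ hid) (cap (isF σ) u v))
                (ℤ.+<+ (s≤s z≤n))))) (R⊆R′ Rv)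

            -- The hidden edge joins `u` in `Y` to `v` outside `Y`, so the forests supply `k` edges
            -- crossing `Y` beyond those known to the base flow.
            fresh-edges : k ≤ ∑₂ (λ x y → 𝟙 (Y x ∧ not (Y y) ∧ rel K₂ x y ∧ not (rel K₁ x y)))
            fresh-edges = ℕ.+-cancelˡ-≤ (crossings (rel K₁) Y) k _ (ℕ.≤-trans
              (crossed Y {u} {v} (hidden-mono {G = G} {rel K₂} {rel (K σ)} (K₂⊆K I) hid)
                λ Yu≡Yv → contradiction (trans (sym Yu) (trans Yu≡Yv Yv)) λ ())
              (ℕ.≤-trans (∑₂-mono λ x y → split (Y x) (not (Y y)) (rel K₁ x y) (rel K₂ x y))
                (ℕ.≤-reflexive (∑₂-+ _ _))))
              where
              Yu : Y u ≡ true
              Yu = cong₂ _∧_ u∈R′ Su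
              Yv : Y v ≡ false
              Yv = trans (cong (λ c → R′ v ∧ not c) Rv) (Bool.∧-zeroʳ (R′ v))
              split : ∀ x y k₁ k₂ → 𝟙 (x ∧ y ∧ k₂) ≤ 𝟙 (x ∧ y ∧ k₁) + 𝟙 (x ∧ y ∧ k₂ ∧ not k₁)
              split false y k₁ k₂ = z≤n
              split true false k₁ k₂ = z≤n
              split true true k₁ false = z≤n
              split true true false true = ℕ.≤-refl
              split true true true true = s≤s z≤n

            -- The base flow is at most 0 outside `K₁`, so it is strictly smaller than `f` here;
            -- skew symmetry reverses the pair.
            saturated⇒below : ∀ x y → rel K₁ x y ≡ false → 1ℤ ℤ.≤ f σ x y → below (f σ) f₀ y x ≡ true
            saturated⇒below x y K₁xy 1≤f = true-does (_ ℤ.<? _)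
              (subst₂ ℤ._<_ (sym (skew (circ (isF σ)) x y)) (sym (skew (circ (isFlow base)) x y))
                (ℤ.neg-mono-< (ℤ.<-≤-trans (ℤ.≤-<-trans
                  (subst (λ c → f₀ x y ℤ.≤ int (𝟙 c)) K₁xy (cap (isFlow base) x y)) (ℤ.+<+ (s≤s z≤n))) 1≤f)))

            full : ∀ L x y → rel K₂ x y ≡ true → rel K₂ ⊆ᴷ L → ¬ Residual L (f σ) x y → 1ℤ ℤ.≤ f σ x y
            full L x y K₂xy K₂⊆L ¬res = subst (λ c → int (𝟙 c) ℤ.≤ f σ x y) (K₂⊆L K₂xy) (ℤ.≮⇒≥ ¬res)

            -- A forest edge leaving Y goes to R or to the complement of R′; either way it is
            -- saturated in f, while f₀ does not use it.
            leaving : ∀ x y → Y x ∧ not (Y y) ∧ rel K₂ x y ∧ not (rel K₁ x y) ≡ true → Y x ∧ moved (f σ) x y ≡ true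
            leaving x y p with ∧-true {Y x} p
            ... | Yx , p′ with ∧-true {not (Y y)} p′
            ... | Yy , p″ with ∧-true {rel K₂ x y} p″ | ∧-true {R′ x} Yx
            ... | K₂xy , K₁xy | R′x , Sx with R y in Ry
            ... | true  = cong₂ _∧_ Yx (trans (cong (below (f σ) f₀ x y ∨_)
                (saturated⇒below x y (Bool.not-injective K₁xy) (full (rel (K σ)) x y K₂xy (K₂⊆K I) λ res →
                  contradiction (trans (sym (cong not (Old.reaches-step (true-does (_ ℤ.<? _) res) Ry))) Sx) λ ())))
                (Bool.∨-zeroʳ _))
            ... | false = cong₂ _∧_ Yx (cong (_∨ below (f σ) f₀ y x)
                (saturated⇒below y x (trans (rel-sym K₁ y x) (Bool.not-injective K₁xy))
                  (full (rel (insert u v (K σ))) y x (trans (rel-sym K₂ y x) K₂xy) (⊆-insert u v (K σ) ∘ K₂⊆K I) λ res →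
                    contradiction (trans (sym (cong (λ r → not (r ∧ true)) (New.reaches-step (true-does (_ ℤ.<? _) res) R′x))) Yy) λ ())))

            -- `R` and `Y` are disjoint parts of `R′`, and each of the `k` forest edges leaving `Y`
            -- is a moved pair with first vertex in `Y`.
            heavier : weight (f σ) R + k ≤ weight (f σ) R′
            heavier = ℕ.≤-trans (ℕ.+-monoʳ-≤ (weight (f σ) R) (ℕ.≤-trans fresh-edges
              (∑₂-mono λ x y → 𝟙-mono (leaving x y)))) (ℕ.≤-trans (ℕ.≤-reflexive (sym (∑₂-+ _ _)))
              (∑₂-mono λ x y → merge (R x) (R′ x) (moved (f σ) x y) (R⊆R′ {x})))
              where
              merge : ∀ r r′ m → (r ≡ true → r′ ≡ true) → 𝟙 (r ∧ m) + 𝟙 ((r′ ∧ not r) ∧ m) ≤ 𝟙 (r′ ∧ m)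
              merge false true  m _ = ℕ.≤-refl
              merge false false m _ = z≤n
              merge true r′ m h with h refl
              ... | refl = ℕ.≤-reflexive (ℕ.+-identityʳ _)

            progress : Progress σ (learned σ u v)
            progress = record
              { K⊆G = insert⊆ᴳ {G = G} (K σ) (K⊆G I) (proj₁ hid) ; K₂⊆K = ⊆-insert u v (K σ) ∘ K₂⊆K I ; b≤a = b≤a I
              ; acyclic = acyclic I
              ; charged = ℕ.≤-trans (ℕ.≤-reflexive (ℕ.+-comm k (stage σ * k))) (ℕ.≤-trans (ℕ.+-monoˡ-≤ k (charged I)) heavier) } ,
              ℕ.+-monoʳ-< (a σ * suc q) (ℕ.n<1+n (stage σ))

          maxPotential : ℕ
          maxPotential = (b + 2 * (Z * Z)) * suc q + q

          runs-step : ∀ σ → Invariant σ → Runs G (searchCost n)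
            (StepPost step source-side {G} {searchCost n} {maxPotential} {Invariant} {IsMinSTCut G s t} potential σ) (step σ)
          runs-step σ I with sink-side σ s Bool.≟ true
          ... | yes r = runs-ret (augment-progress σ r I)
          ... | no s∉R = runs-weaken (ℕ.≤-reflexive (ℕ.+-identityʳ _)) (λ _ p → p)
            (runs-bind {c = 0} (runs-findHidden s _ _ _ (rel-sym (K σ)) (K⊆G I) Bool.not-injective) λ
              { nothing none → runs-ret (minimum σ I s∉R none)
              ; (just (u , v)) (Su , Rv , hid) → runs-ret (Learn.progress σ I u v Su Rv hid) })

        runs-finish : Runs G (suc (2 * (Z * Z) * suc q + q) * searchCost n) (IsMinSTCut G s t)
                        (finish (suc (2 * (Z * Z) * suc q + q)))
        runs-finish = runs-loop step source-side potential
          (λ σ I → ℕ.+-mono-≤ (ℕ.*-monoˡ-≤ (suc q) (nearMax (isF σ) (K⊆G I))) (stage≤q σ I))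
          runs-step _ start
          (record { K⊆G = K₂⊆G ; K₂⊆K = id ; b≤a = ℕ.≤-refl
                  ; acyclic = λ u v lt → contradiction (does-true (f₀ u v ℤ.<? f₀ u v) lt) (ℤ.<-irrefl refl)
                  ; charged = z≤n })
          -- The start already has potential `b * suc q`, so the fuel pays only for the
          -- augmentations above `b`.
          (ℕ.≤-reflexive (cong suc (regroup b (2 * (Z * Z)) q)))
          where
          regroup : ∀ b z q → (b + z) * suc q + q ≡ z * suc q + q + (b * suc q + 0)
          regroup = solve-∀

-- The query bound

*-^ : ∀ k x y → (x * y) ^ k ≡ x ^ k * y ^ k
*-^ zero    x y = refl
*-^ (suc k) x y = trans (cong (x * y *_) (*-^ k x y)) (interchange x y (x ^ k) (y ^ k))
  where
  interchange : ∀ x y a b → x * y * (a * b) ≡ x * a * (y * b)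
  interchange = solve-∀

-- A descent from `m` that stops as soon as the predecessor fails; for a monotone predicate the
-- result is the least index.
firstTrue : {P : ℕ → Set} → (∀ i → Dec (P i)) → ∀ m → P m → ∃ λ i → P i × i ≤ m × (∀ j → i ≡ suc j → ¬ P j)
firstTrue P? zero    p = zero , p , z≤n , λ _ ()
firstTrue P? (suc m) p with P? m
... | no ¬pm = suc m , p , ℕ.≤-refl , λ { _ refl → ¬pm }
... | yes pm = let i , pi , i≤m , before = firstTrue P? m pm in i , pi , ℕ.m≤n⇒m≤1+n i≤m , before

-- d is n^{3/5}, rounded up.
record Scale (n : ℕ) : Set where
  constructor scale
  field
    d         : ℕ
    {{d>0}}   : NonZero d
    d≤n       : d ≤ n
    n³≤d⁵     : n ^ 3 ≤ d ^ 5
    d⁵≤32*n³  : d ^ 5 ≤ 32 * n ^ 3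

-- Rounding up at most doubles: for `d = 2 + e` the predecessor `suc e` has fifth power below n³,
-- and `2 + e` is at most `2 * suc e`. This is the origin of 32 = 2⁵.
chooseScale : ∀ n .{{_ : NonZero n}} → Scale n
chooseScale n with firstTrue (λ d → n ^ 3 ≤? d ^ 5) n (ℕ.^-monoʳ-≤ n {3} {5} (s≤s (s≤s (s≤s z≤n))))
... | zero , n³≤0 , _ , _ = contradiction n³≤0 (ℕ.<⇒≱ (ℕ.m^n>0 n 3))
... | suc zero , n³≤1 , 1≤n , _ = scale 1 1≤n n³≤1 (ℕ.≤-trans (ℕ.m^n>0 n 3) (ℕ.m≤n*m (n ^ 3) 32))
... | suc (suc e) , n³≤d⁵ , d≤n , before = scale (2 + e) d≤n n³≤d⁵ (begin
  (2 + e) ^ 5         ≤⟨ ℕ.^-monoˡ-≤ 5 (ℕ.+-monoʳ-≤ 2 (ℕ.m≤n*m e 2)) ⟩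
  (2 + 2 * e) ^ 5     ≡⟨ cong (_^ 5) (ℕ.*-suc 2 e) ⟨
  (2 * suc e) ^ 5     ≡⟨ *-^ 5 2 (suc e) ⟩
  32 * suc e ^ 5      ≤⟨ ℕ.*-monoʳ-≤ 32 (ℕ.<⇒≤ (ℕ.≰⇒> (before (suc e) refl))) ⟩
  32 * n ^ 3          ∎)
  where open ℕ.≤-Reasoning

-- Opaque: with a numeral c, conversion would unfold (c * 9) ^ 5 * 32 * n ^ 8 in unary.
opaque
  stepConstant : ℕ
  stepConstant = 765

module Budget {n : ℕ} .{{_ : NonZero n}} (S : Scale n) where
  open Scale S

  -- Z bounds the size of a thin pair of levels, q the number of edges learned per augmentation.
  Z : ℕ
  Z = suc ((n + n) / d)

  q : ℕ
  q = 9 * (n * Z) / d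

  <suc[/]* : ∀ m → m < suc (m / d) * d
  <suc[/]* m = ℕ.≤-trans (ℕ.≤-reflexive (cong suc (m≡m%n+[m/n]*n m d))) (ℕ.+-monoˡ-< (m / d * d) (m%n<n m d))

  thin-level : n + n < d * Z
  thin-level = subst (n + n <_) (ℕ.*-comm Z d) (<suc[/]* (n + n))

  stages : 9 * (n * Z) < suc q * d
  stages = <suc[/]* (9 * (n * Z))

  shortSteps finishSteps totalSteps : ℕ
  shortSteps  = suc (d + 2 * (n * d) + suc d * n)
  finishSteps = suc (2 * (Z * Z) * suc q + q)
  totalSteps  = shortSteps + (d * suc n + finishSteps)

  private
    1≤d : 1 ≤ d
    1≤d = >-nonZero⁻¹ d

    Zd≤3n : Z * d ≤ 3 * n
    Zd≤3n = begin
      d + (n + n) / d * d ≤⟨ ℕ.+-mono-≤ d≤n (m/n*n≤m (n + n) d) ⟩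
      n + (n + n)         ≡⟨ cong (λ x → n + (n + x)) (ℕ.+-identityʳ n) ⟨
      3 * n               ∎
      where open ℕ.≤-Reasoning

    qd≤9nZ : q * d ≤ 9 * (n * Z)
    qd≤9nZ = m/n*n≤m (9 * (n * Z)) d

    n³ : n * (n * n) ≤ d * (d * (d * (d * d)))
    n³ = subst₂ _≤_ (cong (λ x → n * (n * x)) (ℕ.*-identityʳ n))
                    (cong (λ x → d * (d * (d * (d * x)))) (ℕ.*-identityʳ d)) n³≤d⁵

    cancel-d⁴ : ∀ {x y} → d * (d * (d * (d * x))) ≤ d * (d * (d * (d * y))) → x ≤ y
    cancel-d⁴ = ℕ.*-cancelˡ-≤ d ∘ ℕ.*-cancelˡ-≤ d ∘ ℕ.*-cancelˡ-≤ d ∘ ℕ.*-cancelˡ-≤ d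

    Z²≤ : Z * Z ≤ 9 * (n * d)
    Z²≤ = cancel-d⁴ (begin
      d * (d * (d * (d * (Z * Z))))       ≡⟨ pull d Z ⟩
      (d * d) * ((Z * d) * (Z * d))       ≤⟨ ℕ.*-mono-≤ (ℕ.*-mono-≤ d≤n d≤n) (ℕ.*-mono-≤ Zd≤3n Zd≤3n) ⟩
      (n * n) * ((3 * n) * (3 * n))       ≡⟨ push n ⟩
      (9 * n) * (n * (n * n))             ≤⟨ ℕ.*-monoʳ-≤ (9 * n) n³ ⟩
      (9 * n) * (d * (d * (d * (d * d)))) ≡⟨ pull′ n d ⟩
      d * (d * (d * (d * (9 * (n * d))))) ∎)
      where
      open ℕ.≤-Reasoning
      pull : ∀ d Z → d * (d * (d * (d * (Z * Z)))) ≡ (d * d) * ((Z * d) * (Z * d))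
      pull = solve-∀
      push : ∀ n → (n * n) * ((3 * n) * (3 * n)) ≡ (9 * n) * (n * (n * n))
      push = solve-∀
      pull′ : ∀ n d → (9 * n) * (d * (d * (d * (d * d)))) ≡ d * (d * (d * (d * (9 * (n * d)))))
      pull′ = solve-∀

    -- The balance that fixes `d`: up to constants `Z` is n/d and `q` is nZ/d, so the product is
    -- n⁴/d⁴, at most nd because n³ ≤ d⁵. Multiplying by d⁴ avoids division. The constant is 3 · 3 ·
    -- 9 · 3, three factors from `Z * d` and the 9 from `q`.
    Z²q≤ : Z * Z * q ≤ 243 * (n * d)
    Z²q≤ = cancel-d⁴ (begin
      d * (d * (d * (d * (Z * Z * q))))         ≡⟨ pull d Z q ⟩
      ((Z * d) * (Z * d)) * (d * (q * d))       ≤⟨ ℕ.*-mono-≤ (ℕ.*-mono-≤ Zd≤3n Zd≤3n) (ℕ.*-monoʳ-≤ d qd≤9nZ) ⟩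
      ((3 * n) * (3 * n)) * (d * (9 * (n * Z))) ≡⟨ swap n d Z ⟩
      (81 * (n * (n * n))) * (Z * d)            ≤⟨ ℕ.*-monoʳ-≤ (81 * (n * (n * n))) Zd≤3n ⟩
      (81 * (n * (n * n))) * (3 * n)            ≡⟨ push n ⟩
      (243 * n) * (n * (n * n))                 ≤⟨ ℕ.*-monoʳ-≤ (243 * n) n³ ⟩
      (243 * n) * (d * (d * (d * (d * d))))     ≡⟨ pull′ n d ⟩
      d * (d * (d * (d * (243 * (n * d)))))     ∎)
      where
      open ℕ.≤-Reasoning
      pull : ∀ d Z q → d * (d * (d * (d * (Z * Z * q)))) ≡ ((Z * d) * (Z * d)) * (d * (q * d))
      pull = solve-∀
      swap : ∀ n d Z → ((3 * n) * (3 * n)) * (d * (9 * (n * Z))) ≡ (81 * (n * (n * n))) * (Z * d)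
      swap = solve-∀
      push : ∀ n → (81 * (n * (n * n))) * (3 * n) ≡ (243 * n) * (n * (n * n))
      push = solve-∀
      pull′ : ∀ n d → (243 * n) * (d * (d * (d * (d * d)))) ≡ d * (d * (d * (d * (243 * (n * d)))))
      pull′ = solve-∀

    d≤nd : d ≤ n * d
    d≤nd = ℕ.m≤n*m d n

    n≤nd : n ≤ n * d
    n≤nd = ℕ.m≤m*n n d

    1≤nd : 1 ≤ n * d
    1≤nd = ℕ.≤-trans 1≤d d≤nd

    shortSteps≤ : shortSteps ≤ 6 * (n * d)
    shortSteps≤ = begin
      suc (d + 2 * (n * d) + (n + d * n))                   ≤⟨ ℕ.+-mono-≤ 1≤nd (ℕ.+-mono-≤ (ℕ.+-monoˡ-≤ (2 * (n * d)) d≤nd) (ℕ.+-monoˡ-≤ (d * n) n≤nd)) ⟩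
      n * d + (n * d + 2 * (n * d) + (n * d + d * n))       ≡⟨ collect n d ⟩
      6 * (n * d)                                           ∎
      where
      open ℕ.≤-Reasoning
      collect : ∀ n d → n * d + (n * d + 2 * (n * d) + (n * d + d * n)) ≡ 6 * (n * d)
      collect = solve-∀

    forestSteps≤ : d * suc n ≤ 2 * (n * d)
    forestSteps≤ = begin
      d * suc n       ≡⟨ ℕ.*-suc d n ⟩
      d + d * n       ≤⟨ ℕ.+-monoˡ-≤ (d * n) d≤nd ⟩
      n * d + d * n   ≡⟨ collect n d ⟩
      2 * (n * d)     ∎
      where
      open ℕ.≤-Reasoning
      collect : ∀ n d → n * d + d * n ≡ 2 * (n * d)
      collect = solve-∀

    finishSteps≤ : finishSteps ≤ 757 * (n * d)
    finishSteps≤ = begin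
      suc (2 * (Z * Z) * suc q + q)
        ≤⟨ ℕ.+-mono-≤ 1≤nd (ℕ.+-monoʳ-≤ (2 * (Z * Z) * suc q) (ℕ.m≤n*m q (Z * Z) {{ℕ.m*n≢0 Z Z}})) ⟩
      n * d + (2 * (Z * Z) * suc q + Z * Z * q)
        ≡⟨ split (n * d) (Z * Z) q ⟩
      n * d + (3 * (Z * Z * q) + 2 * (Z * Z))
        ≤⟨ ℕ.+-monoʳ-≤ (n * d) (ℕ.+-mono-≤ (ℕ.*-monoʳ-≤ 3 Z²q≤) (ℕ.*-monoʳ-≤ 2 Z²≤)) ⟩
      n * d + (3 * (243 * (n * d)) + 2 * (9 * (n * d)))
        -- The coefficients add up to 1 + 729 + 18 = 748; the constant 757 leaves a margin of 9.
        ≤⟨ ℕ.m≤m+n _ (9 * (n * d)) ⟩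
      n * d + (3 * (243 * (n * d)) + 2 * (9 * (n * d))) + 9 * (n * d)
        ≡⟨ collect (n * d) ⟩
      757 * (n * d) ∎
      where
      open ℕ.≤-Reasoning
      split : ∀ x y q → x + (2 * y * suc q + y * q) ≡ x + (3 * (y * q) + 2 * y)
      split = solve-∀
      collect : ∀ x → x + (3 * (243 * x) + 2 * (9 * x)) + 9 * x ≡ 757 * x
      collect = solve-∀

  opaque
    unfolding stepConstant

    totalSteps≤ : totalSteps ≤ stepConstant * (n * d)
    totalSteps≤ = ℕ.≤-trans (ℕ.+-mono-≤ shortSteps≤ (ℕ.+-mono-≤ forestSteps≤ finishSteps≤))
      (ℕ.≤-reflexive (collect (n * d)))
      where
      collect : ∀ x → 6 * x + (2 * x + 757 * x) ≡ 765 * x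
      collect = solve-∀

  -- The fifth power makes the rounding of `d` harmless: n⁵d⁵ is at most 32 n⁸. The single logarithm
  -- per step becomes the exponent 5.
  withinBound : WithinBound ((stepConstant * 9) ^ 5 * 32) 5 n (totalSteps * searchCost n)
  withinBound = begin
    (totalSteps * (9 * L)) ^ 5                   ≤⟨ ℕ.^-monoˡ-≤ 5 (ℕ.*-monoˡ-≤ (9 * L) totalSteps≤) ⟩
    (stepConstant * (n * d) * (9 * L)) ^ 5                ≡⟨ cong (_^ 5) (regroup stepConstant 9 (n * d) L) ⟩
    (stepConstant * 9 * ((n * d) * L)) ^ 5                ≡⟨ distribute (stepConstant * 9) n d L ⟩
    (stepConstant * 9) ^ 5 * (n ^ 5 * d ^ 5 * L ^ 5)      ≤⟨ ℕ.*-monoʳ-≤ ((stepConstant * 9) ^ 5) (ℕ.*-monoˡ-≤ (L ^ 5) (ℕ.*-monoʳ-≤ (n ^ 5) d⁵≤32*n³)) ⟩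
    (stepConstant * 9) ^ 5 * (n ^ 5 * (32 * n ^ 3) * L ^ 5) ≡⟨ combine ((stepConstant * 9) ^ 5) 32 n L ⟩
    (stepConstant * 9) ^ 5 * 32 * n ^ 8 * L ^ 5           ∎
    where
    open ℕ.≤-Reasoning
    L = ⌊log₂ n ⌋ + 1
    regroup : ∀ a b x L → a * x * (b * L) ≡ a * b * (x * L)
    regroup = solve-∀
    distribute : ∀ c n d L → (c * ((n * d) * L)) ^ 5 ≡ c ^ 5 * (n ^ 5 * d ^ 5 * L ^ 5)
    distribute c n d L = trans (*-^ 5 c (n * d * L)) (cong (c ^ 5 *_)
      (trans (*-^ 5 (n * d) L) (cong (_* L ^ 5) (*-^ 5 n d))))
    rearrange : ∀ c e x y z → c * (x * (e * y) * z) ≡ c * e * (x * y) * z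
    rearrange = solve-∀
    combine : ∀ c e n L → c * (n ^ 5 * (e * n ^ 3) * L ^ 5) ≡ c * e * n ^ 8 * L ^ 5
    combine c e n L = trans (rearrange c e (n ^ 5) (n ^ 3) (L ^ 5))
      (cong (λ x → c * e * x * L ^ 5) (sym (ℕ.^-distribˡ-+-* n 5 3)))

-- Assembling the algorithm

module MinCut {n : ℕ} (s t : Fin n) (s≢t : s ≢ t) where

  instance
    n>0 : NonZero n
    n>0 = Fin.nonZeroIndex s

  S : Scale n
  S = chooseScale n

  open Scale S
  open Budget S
  open Flows s t
  open Augmenting s t s≢t
  open LevelSearch d
  open ForestPeeling s using (peels; runs-peels)
  open Finishing s t s≢t

  _⊆?_ : (K K′ : Rel₂ n) → Dec (∀ u v → K u v ≡ true → K′ u v ≡ true)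
  K ⊆? K′ = Fin.all? λ u → Fin.all? λ v → (K u v Bool.≟ true) →-dec (K′ u v Bool.≟ true)

  -- `finish` takes the inclusion of the known edges as data, while a program passes on only the
  -- relations themselves. The inclusion is therefore decided locally, at no query; `runs-peels`
  -- excludes the negative branch.
  conclude : KnownFlow → Known n → Prog n (VSet n)
  conclude φ K₂ with rel (edges φ) ⊆? rel K₂
  ... | yes K₁⊆K₂ = finish φ K₂ (λ {u} {v} → K₁⊆K₂ u v) finishSteps
  ... | no _      = ret (λ _ → true)

  minCut : Prog n (VSet n)
  minCut = findShortAugmentations >>= λ φ → peels d (edges φ) >>= λ K₂ → conclude φ K₂

  runs-minCut : (G : Graph n) → Runs G (totalSteps * searchCost n) (IsMinSTCut G s t) minCut
  runs-minCut G = runs-weaken (ℕ.≤-reflexive (regroup shortSteps d (suc n) finishSteps (searchCost n))) (λ _ p → p)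
    (runs-bind (runs-findShortAugmentations thin-level) λ { φ (K₁⊆G , nearMax) →
      runs-bind (runs-peels d (edges φ) K₁⊆G) λ { K₂ (K₂⊆G , K₁⊆K₂ , crossed) →
        runs-conclude φ K₂ nearMax K₂⊆G K₁⊆K₂ crossed } })
    where
    regroup : ∀ a d n b x → a * x + (d * (n * x) + b * x) ≡ (a + (d * n + b)) * x
    regroup = solve-∀
    runs-conclude : ∀ φ K₂ → (∀ {K f a} → Flow K f a → K ⊆ᴳ G → a ≤ value φ + 2 * (Z * Z)) → rel K₂ ⊆ᴳ G →
      rel (edges φ) ⊆ᴷ rel K₂ →
      (∀ X {u v} → Hidden G (rel K₂) u v → X u ≢ X v → crossings (rel (edges φ)) X + d ≤ crossings (rel K₂) X) →
      Runs G (finishSteps * searchCost n) (IsMinSTCut G s t) (conclude φ K₂)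
    runs-conclude φ K₂ nearMax K₂⊆G K₁⊆K₂ crossed with rel (edges φ) ⊆? rel K₂
    ... | yes K₁⊆K₂′ = runs-finish φ K₂ (λ {u} {v} → K₁⊆K₂′ u v)
        {k = d} {Z} {q} K₂⊆G nearMax crossed stages
    ... | no ⊈ = contradiction (λ u v → K₁⊆K₂) ⊈

  runs-minCutTree : (G : Graph n) → proj₂ (run G (toQTree minCut)) ≤ totalSteps * searchCost n ×
                    IsMinSTCut G s t (proj₁ (run G (toQTree minCut)))
  runs-minCutTree G = runs-toQTree minCut (runs-minCut G)

-- With zero random bits there is a single seed, and the list of failing seeds is empty for every
-- error exponent. Coinciding terminals admit no cut, so any output will do there.
minCutAlg : (n : ℕ) → Fin n → Fin n → RandAlg n
minCutAlg n s t .bits = 0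
minCutAlg n s t .tree _ with s Fin.≟ t
... | yes _  = output (λ _ → true)
... | no s≢t = toQTree (MinCut.minCut s t s≢t)

mainTheorem1 : (c : ℕ) →
    Σ ℕ λ C → Σ ℕ λ k →
    Σ ((n : ℕ) → Fin n → Fin n → RandAlg n) λ A →
    (n : ℕ) (s t : Fin n) → ¬ (s ≡ t) → (G : Graph n) →
    Σ ℕ (λ q → WithinBound C k n q × AlwaysWithin (A n s t) G q)
    × SucceedsWHP (A n s t) G s t c
mainTheorem1 c = (stepConstant * 9) ^ 5 * 32 , 5 , minCutAlg , correct
  where
  correct : (n : ℕ) (s t : Fin n) → ¬ (s ≡ t) → (G : Graph n) →
    Σ ℕ (λ q → WithinBound ((stepConstant * 9) ^ 5 * 32) 5 n q × AlwaysWithin (minCutAlg n s t) G q)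
    × SucceedsWHP (minCutAlg n s t) G s t c
  correct n s t s≢t G with s Fin.≟ t
  ... | yes s≡t = contradiction s≡t s≢t
  ... | no s≢t′ = (_ , Budget.withinBound {{Fin.nonZeroIndex s}} (chooseScale n {{Fin.nonZeroIndex s}}) , λ _ → proj₁ (MinCut.runs-minCutTree s t s≢t′ G)) ,
                  [] , z≤n , λ _ _ → proj₂ (MinCut.runs-minCutTree s t s≢t′ G)
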